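{- Let $r\ge 2$ be a fixed integer, let $Q_d$ be the $d$-dimensional hypercube and let $n=2^d$. Then $\mathcal{D}_r(Q_d,\mathcal{T}_n) = \Theta\left( n/\sqrt{\log n} \right)$ as $d\to\infty$, where the implied constants depend only on $r$.
   Context: $Q_d$ is the graph on vertex set $\{0,1\}^d$ in which two vertices are adjacent iff they differ in exactly one coordinate. Spanning-tree discrepancy: for a connected $n$-vertex graph $G$, an $r$-colouring $f:E(G)\to[r]$ of its edges, and a spanning tree $T$ of $G$ (which has $n-1$ edges), put $D_f(T) := r\cdot\left(\max_{1\le i\le r}|f^{ -1}(i)\cap E(T)| - \frac{n-1}{r}\right)$. The $r$-colour spanning-tree discrepancy of $G$ is $\mathcal{D}_r(G,\mathcal{T}_n) := \min_{f:E(G)\to[r]}\ \max_{T} D_f(T)$, where the maximum is over all spanning trees $T$ of $G$. -}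

module Defs where

open import Level using (0ℓ)
open import Data.Bool using (Bool; true; false)
import Data.Bool.Properties as Bool
open import Data.Fin using (Fin; zero; suc; _<?_; _≟_)
open import Data.Fin.Properties using (*↔×; 2↔Bool; any?; all?)
open import Data.Fin.Subset using (Subset; _∈_; _∩_; ∣_∣)
open import Data.Integer using (+_)
import Data.Integer as ℤ
open import Data.List using (List; []; _∷_; _∷ʳ_; length; lookup; map; filter; allFin; cartesianProduct)
open import Data.List.Extrema.Nat using (max)
open import Data.List.Relation.Unary.Linked using (Linked)
open import Data.List.Relation.Unary.Unique.Propositional using (Unique)
open import Data.Nat using (ℕ; zero; suc; NonZero) renaming (_^_ to _^ℕ_; _≤_ to _≤ℕ_)
open import Data.Product using (∃; ∃-syntax; ∃!; _×_; _,_)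
open import Data.Product.Function.NonDependent.Propositional using (_×-↔_)
open import Data.Rational using (ℚ; 0ℚ; _/_; _-_; _*_; _≤_; _<_)
open import Data.Sum using (_⊎_)
open import Data.Vec using (Vec; []; _∷_; tabulate) renaming (lookup to lookupᵛ)
open import Function using (_∘_)
open import Function.Bundles using (_↔_; mk↔ₛ′; Inverse)
open import Function.Properties.Inverse using (↔-sym; ↔-trans)
open import Relation.Binary.Core using (Rel)
open import Relation.Binary.Construct.Closure.ReflexiveTransitive using (Star)
open import Relation.Binary.Definitions using (Decidable; Symmetric; Irreflexive)
open import Relation.Binary.PropositionalEquality using (_≡_; _≢_; refl; ≢-sym)
open import Relation.Nullary using (¬_; Dec; does; ¬?; map′; _×-dec_; _→-dec_)

-- A finite simple graph on n vertices.  The enumeration of V only serves to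
-- list each unordered pair of vertices once.
record SimpleGraph (n : ℕ) : Set₁ where
  field
    V          : Set
    vertex     : Fin n ↔ V
    Adj        : Rel V 0ℓ
    adj?       : Decidable Adj
    adj-sym    : Symmetric Adj
    adj-irrefl : Irreflexive _≡_ Adj

  nth : Fin n → V
  nth = Inverse.to vertex

  edges : List (Fin n × Fin n)
  edges = filter (λ (i , j) → (i <? j) ×-dec adj? (nth i) (nth j))
                 (cartesianProduct (allFin n) (allFin n))

  -- E(G), each edge being named by its position in the list above.
  E : Set
  E = Fin (length edges)

  EdgeSet : Set
  EdgeSet = Subset (length edges)

  ends : E → V × V
  ends e = let (i , j) = lookup edges e in nth i , nth j

  Joined : EdgeSet → Rel V 0ℓ
  Joined F u v = ∃[ e ] e ∈ F × (ends e ≡ (u , v) ⊎ ends e ≡ (v , u))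

  Connected : EdgeSet → Set
  Connected F = ∀ u v → Star (Joined F) u v

  -- The closed walk v₀ v₁ v₂ vs v₀ with v₀, v₁, v₂, vs distinct: a cycle of
  -- length at least 3.
  IsCycle : EdgeSet → V → V → V → List V → Set
  IsCycle F v₀ v₁ v₂ vs =
    Unique (v₀ ∷ v₁ ∷ v₂ ∷ vs) × Linked (Joined F) ((v₀ ∷ v₁ ∷ v₂ ∷ vs) ∷ʳ v₀)

  Acyclic : EdgeSet → Set
  Acyclic F = ∀ v₀ v₁ v₂ vs → ¬ IsCycle F v₀ v₁ v₂ vs

  IsSpanningTree : EdgeSet → Set
  IsSpanningTree T = Connected T × Acyclic T

Greatest Least : (ℚ → Set) → ℚ → Set
Greatest S q = S q × (∀ p → S p → p ≤ q)
Least    S q = S q × (∀ p → S p → q ≤ p)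

fromℕ : ℕ → ℚ
fromℕ k = + k / 1

module _ {n : ℕ} (r : ℕ) .{{_ : NonZero r}} (G : SimpleGraph n) where
  open SimpleGraph G

  Colouring : Set
  Colouring = E → Fin r

  colourClass : Colouring → Fin r → EdgeSet
  colourClass f i = tabulate (λ e → does (f e ≟ i))

  maxColour : Colouring → EdgeSet → ℕ
  maxColour f T = max 0 (map (λ i → ∣ colourClass f i ∩ T ∣) (allFin r))

  treeDiscrepancy : Colouring → EdgeSet → ℚ
  treeDiscrepancy f T =
    fromℕ r * (fromℕ (maxColour f T) - (+ n ℤ.- + 1) / r)

  IsMaxTreeDiscrepancy : Colouring → ℚ → Set
  IsMaxTreeDiscrepancy f =
    Greatest (λ q → ∃[ T ] IsSpanningTree T × q ≡ treeDiscrepancy f T)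

  -- "q is the r-colour spanning-tree discrepancy of G".  Least and greatest
  -- elements are unique, so at most one q qualifies.
  IsSpanningTreeDiscrepancy : ℚ → Set
  IsSpanningTreeDiscrepancy =
    Least (λ q → ∃[ f ] IsMaxTreeDiscrepancy f q)

DifferInOne : ∀ {d} → Rel (Vec Bool d) 0ℓ
DifferInOne u v = ∃! _≡_ (λ i → lookupᵛ u i ≢ lookupᵛ v i)

differInOne? : ∀ {d} → Decidable (DifferInOne {d})
differInOne? u v =
  any? λ i → differ? i ×-dec
    map′ (λ h {j} → h j) (λ h j → h {j}) (all? λ j → differ? j →-dec (i ≟ j))
  where
  differ? : ∀ i → Dec (lookupᵛ u i ≢ lookupᵛ v i)
  differ? i = ¬? (lookupᵛ u i Bool.≟ lookupᵛ v i)

Fin2^↔Vec : ∀ d → Fin (2 ^ℕ d) ↔ Vec Bool d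
Fin2^↔Vec zero =
  mk↔ₛ′ (λ _ → []) (λ _ → zero) (λ { [] → refl }) (λ { zero → refl })
Fin2^↔Vec (suc d) =
  ↔-trans *↔× (↔-trans (2↔Bool ×-↔ Fin2^↔Vec d)
    (mk↔ₛ′ (λ (b , v) → b ∷ v) (λ { (b ∷ v) → b , v })
           (λ { (_ ∷ _) → refl }) (λ { (_ , _) → refl })))

Q : (d : ℕ) → SimpleGraph (2 ^ℕ d)
Q d = record
  { V          = Vec Bool d
  ; vertex     = Fin2^↔Vec d
  ; Adj        = DifferInOne
  ; adj?       = differInOne?
  ; adj-sym    = λ (i , i≢ , uniq) → i , ≢-sym i≢ , λ j≢ → uniq (≢-sym j≢)
  ; adj-irrefl = λ { refl (i , i≢ , _) → i≢ refl }
  }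

-- D(d) = Θ(g(d)/√h(d)) as d → ∞, i.e. c·g/√h ≤ D ≤ C·g/√h for all large d.
-- There being no real square roots, both inequalities are squared and multiplied
-- by h; wherever h > 0 this is an equivalence, because 0 ≤ D is required too.
-- Rational constants lose nothing against real ones.
_=Θ[_/√_] : (ℕ → ℚ) → (ℕ → ℕ) → (ℕ → ℕ) → Set
D =Θ[ g /√ h ] =
  ∃[ c ] ∃[ C ] 0ℚ < c × 0ℚ < C × ∃[ d₀ ] (∀ d → d₀ ≤ℕ d →
      0ℚ ≤ D d
    × (c * fromℕ (g d)) * (c * fromℕ (g d)) ≤ D d * D d * fromℕ (h d)
    × D d * D d * fromℕ (h d) ≤ (C * fromℕ (g d)) * (C * fromℕ (g d)))

{-# OPTIONS --safe #-}

-- The rank of a set of edges is n minus the number of its components.  Extending a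
-- maximal forest of a colour class to a spanning tree shows that the maximum of
-- maxColour over all spanning trees is the maximum φ of the ranks of the colour
-- classes, and D = r φ − (n − 1).
--
-- Upper bound: cut the layers of the cube into r consecutive blocks of about n/r
-- vertices and give an edge the colour of the block of its lower end.  A class meets
-- at most n/r + 2L vertices, where L = O(n/√d) bounds the layers, so r φ ≤ n + 2rL.
--
-- Lower bound: let q = ⌊d/r⌋.  At every vertex some colour, the dominant one, has
-- degree at least q.  Let S be the set of vertices where a second colour occurs, and
-- Vᵢ the set of the other vertices with dominant colour i.  Assigning to each vertex
-- the reciprocal of the size of its component, summed over the colours, gives
-- r φ ≥ n + |S|/2 − n/q, and similarly φ ≥ |Vᵢ| − n/q.  All neighbours of Vᵢ lie in
-- Vᵢ ∪ S.  Either some Vᵢ contains more than 3/4 of the vertices, and then already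
-- r φ − n is linear in n; or vertex isoperimetry, summed over i, makes S of size at
-- least a constant times n/√d, which exceeds the error n/q.
module Submission where

-- Why vertex isoperimetry: counting the edges that leave Vᵢ only gives |S| of order n/d, because
-- one vertex of S can absorb d of them, and this need not exceed the error n/q. The vertex version
-- gains a factor √d. It is needed only up to a constant, and only for sets that leave a quarter of
-- the cube free. So the exact theorem is replaced by |B| ≥ |A| + |A||Aᶜ|/(8 s n), where B contains
-- A and its neighbours and s is about √d; an inequality with such a product can be carried from the
-- two half cubes to the cube.
--
-- Why |S|/2: a colour absent at v contributes 1 to the sum of reciprocals, the dominant one at most
-- 1/q, and a second colour at most 1/2, since its component contains v and a neighbour.
--
-- Trees are defined by forbidding cycles, while ranks are counts. The link is a labelling of the
-- vertices by representatives of their components, together with the equation |F| + number of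
-- components = n.
--
-- Estimates are stated over the naturals with denominators multiplied out and subtracted terms
-- moved to the other side; rationals enter only for the final statement.

open import Defs
import Algebra.Properties.CommutativeSemigroup as CommutativeSemigroupProperties
open import Algebra.Bundles using (CommutativeRing)
import Data.Bool as Bool
open import Data.Bool using (Bool; true; false; if_then_else_; not)
open import Data.Bool.Properties using (not-involutive; not-¬)
open import Data.Empty using (⊥-elim) renaming (⊥ to Empty)
import Data.Fin as Fin
open import Data.Fin using (Fin; zero; suc; toℕ; fromℕ<; _↑ˡ_; _↑ʳ_)
import Data.Fin.Properties as Fin
open import Data.Fin.Subset using (Subset; inside; outside; _∈_; _∉_; _⊆_; _∩_; _-_; ∣_∣; ⊥)
open import Data.Fin.Subset.Properties
  using (p⊆q⇒∣p∣≤∣q∣; x∈p⇒∣p-x∣<∣p∣; ∣⊥∣≡0; ∉⊥; _∈?_; x∈p∧x≢y⇒x∈p-y; x∈p∩q⁻; x∈p∩q⁺)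
open import Data.Integer using () renaming (+_ to pos)
import Data.Integer as ℤ
import Data.Integer.Properties as ℤ
import Data.Integer.Tactic.RingSolver as ℤ-Solver
open import Data.List
  using (List; length; []; _∷_; _∷ʳ_; map; allFin; lookup; filter; cartesianProduct)
open import Data.List.Extrema.Nat using (max)
import Data.List.Extrema.Nat as Extrema
open import Data.List.Membership.Propositional using () renaming (_∈_ to _∈ˡ_)
open import Data.List.Membership.Propositional.Properties
  using (∈-lookup; ∈-filter⁻; ∈-filter⁺; ∈-cartesianProduct⁺; ∈-allFin; ∈-map⁺)
open import Data.List.Relation.Unary.All using (All; []; _∷_)
import Data.List.Relation.Unary.All as All
import Data.List.Relation.Unary.All.Properties as All
open import Data.List.Relation.Unary.AllPairs using ([]; _∷_)
open import Data.List.Relation.Unary.Any using (here; there)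
import Data.List.Relation.Unary.Any as Any
import Data.List.Relation.Unary.Any.Properties as Any
open import Data.List.Relation.Unary.Linked using (Linked; [-]; _∷_)
import Data.List.Relation.Unary.Linked as Linked
open import Data.List.Relation.Unary.Unique.Propositional using (Unique)
import Data.List.Relation.Unary.Unique.Propositional.Properties as Unique
open import Data.Nat
  using (ℕ; zero; suc; pred; NonZero; >-nonZero; _≤_; _<_; _^_; _+_; _*_; _∸_; _⊓_; _/_; _%_;
         z≤n; s≤s; s≤s⁻¹; _≤?_; _<?_)
import Data.Nat.Coprimality as Coprimality
open import Data.Nat.DivMod
  using (m/n*n≤m; m≡m%n+[m/n]*n; m%n<n; m<n*o⇒m/o<n; m*n/n≡m; /-monoˡ-≤)
open import Data.Nat.Logarithm using (⌊log₂_⌋; ⌊log₂[2^n]⌋≡n)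
import Data.Nat.Properties as ℕ
open import Data.Nat.Tactic.RingSolver using (solve-∀)
open import Data.Product using (∃-syntax; _×_; _,_; proj₁; proj₂)
open import Data.Rational using (ℚ)
import Data.Rational as ℚ
import Data.Rational.Properties as ℚ
open import Data.Rational.Unnormalised using (mkℚᵘ; *≡*)
import Data.Rational.Unnormalised as ℚᵘ
import Data.Rational.Unnormalised.Properties as ℚᵘ
open import Data.Sum using (_⊎_; inj₁; inj₂)
import Data.Sum as Sum
open import Data.Vec using (Vec; []; _∷_; _[_]≔_) renaming (lookup to lookupᵛ)
import Data.Vec as Vec
import Data.Vec.Properties as Vec
open import Function using (_∘_; id; case_of_)
open import Function.Bundles using (Inverse)
open import Relation.Binary.Construct.Closure.ReflexiveTransitive using (Star; ε; _◅_; _◅◅_; _⋆)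
import Relation.Binary.Construct.Closure.ReflexiveTransitive as Star
open import Relation.Binary.Definitions using (tri<; tri≈; tri>)
open import Relation.Binary.PropositionalEquality
  using (_≡_; _≢_; refl; sym; trans; cong; cong₂; subst; subst₂; ≢-sym; module ≡-Reasoning)
open import Relation.Nullary
  using (¬_; Dec; yes; no; does; ¬?; _×-dec_; _⊎-dec_; map′; contradiction)
open import Relation.Nullary.Decidable using (dec-true; decidable-stable)
open import Algebra.Properties.CommutativeMonoid.Sum ℕ.+-0-commutativeMonoid
  using (sum; sum-cong-≗; ∑-distrib-+; ∑-comm)

-- Finite sums

opaque
  -- Opaque, so that cardinalities, which are sums of `χ`, are handled through the lemmas below and
  -- never unfold into decision procedures.
  χ : ∀ {p} {P : Set p} → Dec P → ℕ
  χ P? = if does P? then 1 else 0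

  χ-yes : ∀ {p} {P : Set p} (P? : Dec P) → P → χ P? ≡ 1
  χ-yes (yes _) _ = refl
  χ-yes (no ¬p) p = contradiction p ¬p

  χ-no : ∀ {p} {P : Set p} (P? : Dec P) → ¬ P → χ P? ≡ 0
  χ-no (yes p) ¬p = contradiction p ¬p
  χ-no (no _)  _  = refl

  χ-mono : ∀ {p q} {P : Set p} {Q : Set q} (P? : Dec P) (Q? : Dec Q) → (P → Q) → χ P? ≤ χ Q?
  χ-mono (no _)  Q? f = z≤n
  χ-mono (yes p) Q? f = ℕ.≤-reflexive (sym (χ-yes Q? (f p)))

  χ-cong : ∀ {p q} {P : Set p} {Q : Set q} (P? : Dec P) (Q? : Dec Q) → (P → Q) → (Q → P) → χ P? ≡ χ Q?
  χ-cong P? Q? f g = ℕ.≤-antisym (χ-mono P? Q? f) (χ-mono Q? P? g)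

  χ≤1 : ∀ {p} {P : Set p} (P? : Dec P) → χ P? ≤ 1
  χ≤1 (yes _) = ℕ.≤-refl
  χ≤1 (no _)  = z≤n

sum-mono : ∀ {n} {f g : Fin n → ℕ} → (∀ i → f i ≤ g i) → sum f ≤ sum g
sum-mono {zero}  f≤g = z≤n
sum-mono {suc n} f≤g = ℕ.+-mono-≤ (f≤g zero) (sum-mono (f≤g ∘ suc))

sum-const : ∀ n c → sum {n} (λ _ → c) ≡ n * c
sum-const zero    c = refl
sum-const (suc n) c = cong (c +_) (sum-const n c)

sum-*ˡ : ∀ {n} c (f : Fin n → ℕ) → c * sum f ≡ sum (λ i → c * f i)
sum-*ˡ {zero}  c f = ℕ.*-zeroʳ c
sum-*ˡ {suc n} c f = trans (ℕ.*-distribˡ-+ c (f zero) _) (cong (c * f zero +_) (sum-*ˡ c (f ∘ suc)))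

sum-*ʳ : ∀ {n} c (f : Fin n → ℕ) → sum f * c ≡ sum (λ i → f i * c)
sum-*ʳ {zero}  c f = refl
sum-*ʳ {suc n} c f = trans (ℕ.*-distribʳ-+ c (f zero) _) (cong (f zero * c +_) (sum-*ʳ c (f ∘ suc)))

sum-zero : ∀ {n} {f : Fin n → ℕ} → (∀ i → f i ≡ 0) → sum f ≡ 0
sum-zero {n} f≡0 = trans (sum-cong-≗ f≡0) (trans (sum-const n 0) (ℕ.*-zeroʳ n))

sum-single : ∀ {n} {f : Fin n → ℕ} j → (∀ i → i ≢ j → f i ≡ 0) → sum f ≡ f j
sum-single {f = f} zero    z =
  trans (cong (f zero +_) (sum-zero (λ i → z (suc i) λ ()))) (ℕ.+-identityʳ _)
sum-single {f = f} (suc j) z =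
  trans (cong (_+ sum (f ∘ suc)) (z zero λ ())) (sum-single j λ i i≢j → z (suc i) (i≢j ∘ Fin.suc-injective))

sum-↑ : ∀ m {n} (f : Fin (m + n) → ℕ) → sum f ≡ sum (λ i → f (i ↑ˡ n)) + sum (λ i → f (m ↑ʳ i))
sum-↑ zero    f = refl
sum-↑ (suc m) f = trans (cong (f zero +_) (sum-↑ m (f ∘ suc))) (sym (ℕ.+-assoc (f zero) _ _))

≤-sum : ∀ {n} (f : Fin n → ℕ) j → f j ≤ sum f
≤-sum f zero    = ℕ.m≤m+n _ _
≤-sum f (suc j) = ℕ.≤-trans (≤-sum (f ∘ suc) j) (ℕ.m≤n+m _ _)

module _ {m n} {P : Fin m → Set} {Q : Fin n → Set} (P? : ∀ i → Dec (P i)) (Q? : ∀ j → Dec (Q j))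
         (h : Fin m → Fin n) (h-inj : ∀ {i j} → P i → P j → h i ≡ h j → i ≡ j) (h-img : ∀ {i} → P i → Q (h i)) where

  private
    g : Fin m → Fin n → ℕ
    g i j = χ (P? i ×-dec (h i Fin.≟ j))

    row : ∀ i → χ (P? i) ≡ sum (g i)
    row i = sym (trans (sum-single (h i) λ j j≢ → χ-no (P? i ×-dec (h i Fin.≟ j)) (≢-sym j≢ ∘ proj₂))
                       (χ-cong (P? i ×-dec (h i Fin.≟ h i)) (P? i) proj₁ (_, refl)))

    column : ∀ j → sum (λ i → g i j) ≤ χ (Q? j)
    column j with Fin.any? (λ i → P? i ×-dec (h i Fin.≟ j))
    ... | yes (i , p , refl) =
      subst (_≤ χ (Q? (h i)))
        (sym (sum-single i λ i′ i′≢i → χ-no (P? i′ ×-dec (h i′ Fin.≟ h i)) λ (p′ , eq) → i′≢i (h-inj p′ p eq)))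
        (χ-mono (P? i ×-dec (h i Fin.≟ h i)) (Q? (h i)) (h-img ∘ proj₁))
    ... | no none =
      subst (_≤ χ (Q? j)) (sym (sum-zero λ i → χ-no (P? i ×-dec (h i Fin.≟ j)) λ p → none (i , p))) z≤n

  -- Double counting of the pairs `(i , h i)` with `P i`: each such row holds exactly one, each
  -- column at most one by injectivity, and a column outside `Q` none.
  count-injection : sum (χ ∘ P?) ≤ sum (χ ∘ Q?)
  count-injection = begin
    sum (χ ∘ P?)                     ≡⟨ sum-cong-≗ row ⟩
    sum (λ i → sum (g i))            ≡⟨ ∑-comm g ⟩
    sum (λ j → sum (λ i → g i j))    ≤⟨ sum-mono column ⟩
    sum (χ ∘ Q?)                     ∎
    where open ℕ.≤-Reasoning

-- Spanning forests

insert : ∀ {m} → Fin m → Subset m → Subset m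
insert e F = F [ e ]≔ inside

∣insert∣ : ∀ {m} (e : Fin m) (F : Subset m) → e ∉ F → ∣ insert e F ∣ ≡ suc ∣ F ∣
∣insert∣ zero    (inside  ∷ F) e∉F = contradiction Vec.here e∉F
∣insert∣ zero    (outside ∷ F) e∉F = refl
∣insert∣ (suc e) (inside  ∷ F) e∉F = cong suc (∣insert∣ e F (e∉F ∘ Vec.there))
∣insert∣ (suc e) (outside ∷ F) e∉F = ∣insert∣ e F (e∉F ∘ Vec.there)

∈-insert : ∀ {m} (e : Fin m) (F : Subset m) → e ∈ insert e F
∈-insert zero    (_ ∷ F) = Vec.here
∈-insert (suc e) (_ ∷ F) = Vec.there (∈-insert e F)

⊆-insert : ∀ {m} (e : Fin m) (F : Subset m) → F ⊆ insert e F
⊆-insert zero    (_ ∷ F) Vec.here      = Vec.here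
⊆-insert zero    (_ ∷ F) (Vec.there p) = Vec.there p
⊆-insert (suc e) (_ ∷ F) Vec.here      = Vec.here
⊆-insert (suc e) (_ ∷ F) (Vec.there p) = Vec.there (⊆-insert e F p)

insert⁻ : ∀ {m} (e : Fin m) (F : Subset m) {e′} → e′ ∈ insert e F → e′ ≡ e ⊎ e′ ∈ F
insert⁻ zero    (_ ∷ F) Vec.here      = inj₁ refl
insert⁻ zero    (_ ∷ F) (Vec.there p) = inj₂ (Vec.there p)
insert⁻ (suc e) (_ ∷ F) Vec.here      = inj₂ Vec.here
insert⁻ (suc e) (_ ∷ F) (Vec.there p) with insert⁻ e F p
... | inj₁ refl = inj₁ refl
... | inj₂ q    = inj₂ (Vec.there q)

module Graph {n : ℕ} (G : SimpleGraph n) where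
  open SimpleGraph G public

  index : V → Fin n
  index = Inverse.from vertex

  nth-index : ∀ v → nth (index v) ≡ v
  nth-index = Inverse.strictlyInverseˡ vertex

  index-nth : ∀ i → index (nth i) ≡ i
  index-nth = Inverse.strictlyInverseʳ vertex

  index-injective : ∀ {u v} → index u ≡ index v → u ≡ v
  index-injective {u} {v} eq = trans (sym (nth-index u)) (trans (cong nth eq) (nth-index v))

  nth-injective : ∀ {i j} → nth i ≡ nth j → i ≡ j
  nth-injective {i} {j} eq = trans (sym (index-nth i)) (trans (cong index eq) (index-nth j))

  infix 4 _≟V_
  opaque
    _≟V_ : (u v : V) → Dec (u ≡ v)
    u ≟V v = map′ index-injective (cong index) (index u Fin.≟ index v)

  ∑V : (V → ℕ) → ℕ
  ∑V h = sum (h ∘ nth)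

  ∑V-single : ∀ (h : V → ℕ) y → (∀ x → x ≢ y → h x ≡ 0) → ∑V h ≡ h y
  ∑V-single h y z = trans (sum-single (index y) λ i i≢ → z (nth i) λ eq → i≢ (trans (sym (index-nth i)) (cong index eq)))
                          (cong h (nth-index y))

  module _ {P Q : V → Set} (P? : ∀ x → Dec (P x)) (Q? : ∀ x → Dec (Q x)) where
    ∑V-injection : (h : V → V) → (∀ {x y} → P x → P y → h x ≡ h y → x ≡ y) → (∀ {x} → P x → Q (h x)) →
                   ∑V (χ ∘ P?) ≤ ∑V (χ ∘ Q?)
    ∑V-injection h h-inj h-img = count-injection (P? ∘ nth) (Q? ∘ nth) (index ∘ h ∘ nth)
      (λ p q eq → nth-injective (h-inj p q (index-injective eq)))
      (λ p → subst Q (sym (nth-index _)) (h-img p))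

  -- A labelling l : V → V sends a vertex to the representative of its class, so
  -- that fix l is the number of classes.
  fix : (V → V) → ℕ
  fix l = ∑V (λ x → χ (l x ≟V x))

  fix-id : fix id ≡ n
  fix-id = trans (sum-cong-≗ λ i → χ-yes (nth i ≟V nth i) refl) (trans (sum-const n 1) (ℕ.*-identityʳ n))

  head tail : E → V
  head e = proj₁ (ends e)
  tail e = proj₂ (ends e)

  Joined-sym : ∀ {F u v} → Joined F u v → Joined F v u
  Joined-sym (e , e∈F , inj₁ eq) = e , e∈F , inj₂ eq
  Joined-sym (e , e∈F , inj₂ eq) = e , e∈F , inj₁ eq

  Joined-⊆ : ∀ {F F′} → F ⊆ F′ → ∀ {u v} → Joined F u v → Joined F′ u v
  Joined-⊆ F⊆F′ (e , e∈F , eq) = e , F⊆F′ e∈F , eq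

  Star-sym : ∀ {F u v} → Star (Joined F) u v → Star (Joined F) v u
  Star-sym = Star.reverse Joined-sym

  Compatible : (V → V) → EdgeSet → Set
  Compatible l F = ∀ e → e ∈ F → l (head e) ≡ l (tail e)

  Compatible-Joined : ∀ {l F u v} → Compatible l F → Joined F u v → l u ≡ l v
  Compatible-Joined c (e , e∈F , inj₁ refl) = c e e∈F
  Compatible-Joined c (e , e∈F , inj₂ refl) = sym (c e e∈F)

  Compatible-Star : ∀ {l F u v} → Compatible l F → Star (Joined F) u v → l u ≡ l v
  Compatible-Star c ε        = refl
  Compatible-Star c (j ◅ js) = trans (Compatible-Joined c j) (Compatible-Star c js)

  -- `path` and `compatible` together make the classes of `lab` the components of `F`. That `F` has
  -- no cycle is expressed by `card` alone, which is easy to maintain when edges are added.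
  record Forest (F : EdgeSet) : Set where
    field
      lab        : V → V
      lab-idem   : ∀ x → lab (lab x) ≡ lab x
      path       : ∀ x → Star (Joined F) x (lab x)
      compatible : Compatible lab F
      card       : ∣ F ∣ + fix lab ≡ n

  open Forest

  empty : Forest ⊥
  empty = record
    { lab = id ; lab-idem = λ _ → refl ; path = λ _ → ε ; compatible = λ _ _∈⊥ → contradiction _∈⊥ ∉⊥
    ; card = cong₂ _+_ (∣⊥∣≡0 (length edges)) fix-id }

  module Merge {F} (Φ : Forest F) (e : E) (l≢ : lab Φ (head e) ≢ lab Φ (tail e)) where
    private
      l = lab Φ
      u = l (head e)
      v = l (tail e)

    redirect : V → V
    redirect y with y ≟V u
    ... | yes _ = v
    ... | no _  = y

    redirect-u : redirect u ≡ v
    redirect-u with u ≟V u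
    ... | yes _  = refl
    ... | no u≢u = contradiction refl u≢u

    redirect-≢ : ∀ {y} → y ≢ u → redirect y ≡ y
    redirect-≢ {y} y≢u with y ≟V u
    ... | yes y≡u = contradiction y≡u y≢u
    ... | no _    = refl

    merged : V → V
    merged = redirect ∘ l

    private
      v≢u : v ≢ u
      v≢u = ≢-sym l≢

      merged-v : merged v ≡ v
      merged-v = trans (cong redirect (lab-idem Φ _)) (redirect-≢ v≢u)

      idem : ∀ x → merged (merged x) ≡ merged x
      idem x with l x ≟V u
      ... | yes _    = merged-v
      ... | no lx≢u = trans (cong redirect (lab-idem Φ x)) (redirect-≢ lx≢u)

      e∉F : e ∉ F
      e∉F e∈F = l≢ (compatible Φ e e∈F)

      paths : ∀ x → Star (Joined (insert e F)) x (merged x)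
      paths x with l x ≟V u
      ... | yes lx≡u =
        Star.map (Joined-⊆ (⊆-insert e F)) (subst (Star (Joined F) x) lx≡u (path Φ x) ◅◅ Star-sym (path Φ _))
        ◅◅ (e , ∈-insert e F , inj₁ refl) ◅ Star.map (Joined-⊆ (⊆-insert e F)) (path Φ _)
      ... | no _ = Star.map (Joined-⊆ (⊆-insert e F)) (path Φ x)

      compat : Compatible merged (insert e F)
      compat e′ e′∈ with insert⁻ e F e′∈
      ... | inj₁ refl = trans redirect-u (sym (redirect-≢ v≢u))
      ... | inj₂ e′∈F = cong redirect (compatible Φ e′ e′∈F)

      pointwise : ∀ x → χ (l x ≟V x) ≡ χ (merged x ≟V x) + χ (x ≟V u)
      pointwise x with x ≟V u
      ... | yes refl = trans (χ-yes (l u ≟V u) (lab-idem Φ _))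
                             (sym (cong₂ _+_ (χ-no (merged u ≟V u) λ eq →
                               v≢u (trans (sym (trans (cong redirect (lab-idem Φ _)) redirect-u)) eq)) (χ-yes (yes refl) refl)))
      ... | no x≢u = trans (χ-cong (l x ≟V x) (merged x ≟V x) to from)
                         (sym (trans (cong (χ (merged x ≟V x) +_) (χ-no (no x≢u) x≢u)) (ℕ.+-identityʳ _)))
        where
        to : l x ≡ x → merged x ≡ x
        to lx≡x = trans (cong redirect lx≡x) (redirect-≢ x≢u)
        from : merged x ≡ x → l x ≡ x
        from mx≡x with l x ≟V u
        ... | yes _ = trans (cong l (sym mx≡x)) (trans (lab-idem Φ _) mx≡x)
        ... | no _  = mx≡x

      -- The one representative lost is `u`, whose class is absorbed by that of `v`; this balances
      -- the new edge in `card`.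
      fix-merged : fix l ≡ suc (fix merged)
      fix-merged = begin
        fix l                                                ≡⟨ sum-cong-≗ (pointwise ∘ nth) ⟩
        sum (λ i → χ (merged (nth i) ≟V nth i) + χ (nth i ≟V u)) ≡⟨ ∑-distrib-+ (λ i → χ (merged (nth i) ≟V nth i)) (λ i → χ (nth i ≟V u)) ⟩
        fix merged + ∑V (λ x → χ (x ≟V u))                   ≡⟨ cong (fix merged +_) (trans (∑V-single _ u λ x x≢u → χ-no (x ≟V u) x≢u) (χ-yes (u ≟V u) refl)) ⟩
        fix merged + 1                                       ≡⟨ ℕ.+-comm _ 1 ⟩
        suc (fix merged)                                     ∎
        where open ≡-Reasoning

    merge : Forest (insert e F)
    merge = record
      { lab = merged ; lab-idem = idem ; path = paths ; compatible = compat
      ; card = trans (cong (_+ fix merged) (∣insert∣ e F e∉F))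
                     (trans (sym (ℕ.+-suc ∣ F ∣ (fix merged))) (trans (cong (∣ F ∣ +_) (sym fix-merged)) (card Φ))) }

  -- `absorbs` is maximality: no edge of `es` joins two components any more. Used from the empty
  -- forest to exhaust a colour class, and from such a forest to reach a spanning tree.
  record Growth (F : EdgeSet) (es : List E) : Set where
    field
      grown    : EdgeSet
      forest   : Forest grown
      extends  : F ⊆ grown
      origin   : ∀ e → e ∈ grown → e ∈ F ⊎ e ∈ˡ es
      absorbs  : ∀ e → e ∈ˡ es → lab forest (head e) ≡ lab forest (tail e)

  open Growth

  grow : ∀ {F} → Forest F → (es : List E) → Growth F es
  grow Φ [] = record
    { grown = _ ; forest = Φ ; extends = id ; origin = λ _ → inj₁ ; absorbs = λ _ () }
  grow Φ (e ∷ es) with grow Φ es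
  ... | γ with lab (forest γ) (head e) ≟V lab (forest γ) (tail e)
  ...   | yes l≡ = record
    { grown = grown γ ; forest = forest γ ; extends = extends γ
    ; origin = λ e′ e′∈ → case origin γ e′ e′∈ of λ { (inj₁ p) → inj₁ p ; (inj₂ q) → inj₂ (there q) }
    ; absorbs = λ { e′ (here refl) → l≡ ; e′ (there e′∈) → absorbs γ e′ e′∈ } }
  ...   | no l≢ = record
    { grown = insert e (grown γ) ; forest = merge ; extends = ⊆-insert e (grown γ) ∘ extends γ
    ; origin = λ e′ e′∈ → case insert⁻ e (grown γ) e′∈ of λ
        { (inj₁ refl) → inj₂ (here refl)
        ; (inj₂ q) → case origin γ e′ q of λ { (inj₁ p) → inj₁ p ; (inj₂ q) → inj₂ (there q) } }
    ; absorbs = λ { e′ (here refl) → compatible merge e (∈-insert e (grown γ))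
                  ; e′ (there e′∈) → cong redirect (absorbs γ e′ e′∈) } }
    where open Merge (forest γ) e l≢

-- Forests are exactly the acyclic edge sets

Unique-lookup : ∀ {A : Set} {xs : List A} → Unique xs → ∀ i j → lookup xs i ≡ lookup xs j → i ≡ j
Unique-lookup (_  ∷ _) zero    zero    _  = refl
Unique-lookup (x∉ ∷ _) zero    (suc j) eq = contradiction eq (All.lookup x∉ (∈-lookup j))
Unique-lookup (x∉ ∷ _) (suc i) zero    eq = contradiction (sym eq) (All.lookup x∉ (∈-lookup i))
Unique-lookup (_  ∷ u) (suc i) (suc j) eq = cong suc (Unique-lookup u i j eq)

module Cycle {n : ℕ} (G : SimpleGraph n) where
  open Graph G public
  open Forest
  open Growth

  private
    pair? : ∀ ((i , j) : Fin n × Fin n) → Dec (i Fin.< j × Adj (nth i) (nth j))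
    pair? (i , j) = (i Fin.<? j) ×-dec adj? (nth i) (nth j)

    edge-pair : ∀ e → let (i , j) = lookup edges e in i Fin.< j × Adj (nth i) (nth j)
    edge-pair e = proj₂ (∈-filter⁻ pair? {xs = cartesianProduct (allFin n) (allFin n)} (∈-lookup e))

    lookup-edges-injective : ∀ e e′ → lookup edges e ≡ lookup edges e′ → e ≡ e′
    lookup-edges-injective = Unique-lookup
      (Unique.filter⁺ pair? (Unique.cartesianProduct⁺ (Unique.allFin⁺ n) (Unique.allFin⁺ n)))

    pair-edge : ∀ i j → i Fin.< j → Adj (nth i) (nth j) → ∃[ e ] lookup edges e ≡ (i , j)
    pair-edge i j i<j adj = Any.index ∈edges , sym (Any.lookup-index ∈edges)
      where
      ∈edges : (i , j) ∈ˡ edges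
      ∈edges = ∈-filter⁺ pair? (∈-cartesianProduct⁺ (∈-allFin i) (∈-allFin j)) (i<j , adj)

  Joins : E → V → V → Set
  Joins e u v = ends e ≡ (u , v) ⊎ ends e ≡ (v , u)

  edge-adj : ∀ e → Adj (head e) (tail e)
  edge-adj e = proj₂ (edge-pair e)

  Adj⇒≢ : ∀ {u v} → Adj u v → u ≢ v
  Adj⇒≢ adj u≡v = adj-irrefl u≡v adj

  Joins-≢ : ∀ {e u v} → Joins e u v → u ≢ v
  Joins-≢ {e} (inj₁ refl) = Adj⇒≢ (edge-adj e)
  Joins-≢ {e} (inj₂ refl) = Adj⇒≢ (adj-sym (edge-adj e))

  edge : ∀ {u v} → Adj u v → ∃[ e ] Joins e u v
  edge {u} {v} adj with Fin.<-cmp (index u) (index v)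
  ... | tri< i<j _ _ =
    let (e , eq) = pair-edge _ _ i<j (subst₂ Adj (sym (nth-index u)) (sym (nth-index v)) adj)
    in e , inj₁ (cong₂ _,_ (trans (cong (nth ∘ proj₁) eq) (nth-index u)) (trans (cong (nth ∘ proj₂) eq) (nth-index v)))
  ... | tri≈ _ i≡j _ = contradiction (index-injective i≡j) (Adj⇒≢ adj)
  ... | tri> _ _ j<i =
    let (e , eq) = pair-edge _ _ j<i (subst₂ Adj (sym (nth-index v)) (sym (nth-index u)) (adj-sym adj))
    in e , inj₂ (cong₂ _,_ (trans (cong (nth ∘ proj₁) eq) (nth-index v)) (trans (cong (nth ∘ proj₂) eq) (nth-index u)))

  -- Each edge is listed with its smaller index first and without repetition, so neither a reversed
  -- nor a second copy can occur.
  edge-unique : ∀ {e e′ u v} → Joins e u v → Joins e′ u v → e ≡ e′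
  edge-unique {e} {e′} = λ where
      (inj₁ p) (inj₁ q) → same (trans p (sym q))
      (inj₂ p) (inj₂ q) → same (trans p (sym q))
      (inj₁ p) (inj₂ q) → ⊥-elim (swapped p q)
      (inj₂ p) (inj₁ q) → ⊥-elim (swapped p q)
    where
    same : ends e ≡ ends e′ → e ≡ e′
    same eq = lookup-edges-injective e e′ (cong₂ _,_ (nth-injective (cong proj₁ eq)) (nth-injective (cong proj₂ eq)))
    swapped : ∀ {u v} → ends e ≡ (u , v) → ends e′ ≡ (v , u) → Empty
    swapped p q = ℕ.<-asym (proj₁ (edge-pair e))
      (subst₂ Fin._<_ (nth-injective (trans (cong proj₁ q) (sym (cong proj₂ p))))
                      (nth-injective (trans (cong proj₂ q) (sym (cong proj₁ p)))) (proj₁ (edge-pair e′)))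

  -- `g` sends the representatives of the coarser labelling `l` injectively to representatives of
  -- `g`.
  fix-≤ : ∀ {l g : V → V} → (∀ x → g (g x) ≡ g x) → (∀ {x y} → g x ≡ g y → l x ≡ l y) → fix l ≤ fix g
  fix-≤ {l} {g} g-idem finer = ∑V-injection (λ x → l x ≟V x) (λ x → g x ≟V x) g
    (λ p q eq → trans (sym p) (trans (finer eq) q)) (λ _ → g-idem _)

  elements : EdgeSet → List E
  elements C = filter (_∈? C) (allFin (length edges))

  ∈-elements : ∀ {C e} → e ∈ C → e ∈ˡ elements C
  ∈-elements {C} e∈C = ∈-filter⁺ (_∈? C) (∈-allFin _) e∈C

  elements-∈ : ∀ {C e} → e ∈ˡ elements C → e ∈ C
  elements-∈ {C} e∈ = proj₂ (∈-filter⁻ (_∈? C) {xs = allFin (length edges)} e∈)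

  module Spanning (C : EdgeSet) where
    growth : Growth ⊥ (elements C)
    growth = grow empty (elements C)

    F : EdgeSet
    F = grown growth

    forestF : Forest F
    forestF = forest growth

    label : V → V
    label = lab forestF

    F⊆C : F ⊆ C
    F⊆C {e} e∈F = case origin growth e e∈F of λ { (inj₁ e∈⊥) → contradiction e∈⊥ ∉⊥ ; (inj₂ e∈) → elements-∈ e∈ }

    label-compatible : Compatible label C
    label-compatible e e∈C = absorbs growth e (∈-elements e∈C)

  -- Every `x` lies in the same component of `F` as `g x`, so the components are unions of classes
  -- of `g`; a maximal forest inside `F` therefore has at most `fix g` of them.
  connected-bound : ∀ {F} (g : V → V) → (∀ x → g (g x) ≡ g x) → (∀ x → Star (Joined F) x (g x)) → n ≤ ∣ F ∣ + fix g
  connected-bound {F} g g-idem walk = begin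
    n                  ≡⟨ card forestF ⟨
    ∣ S.F ∣ + fix label ≤⟨ ℕ.+-mono-≤ (p⊆q⇒∣p∣≤∣q∣ F⊆C) (fix-≤ g-idem finer) ⟩
    ∣ F ∣ + fix g      ∎
    where
    module S = Spanning F
    open S hiding (F)
    open ℕ.≤-Reasoning
    to-root : ∀ x → label x ≡ label (g x)
    to-root x = Compatible-Star label-compatible (walk x)
    finer : ∀ {x y} → g x ≡ g y → label x ≡ label y
    finer {x} {y} eq = trans (to-root x) (trans (cong label eq) (sym (to-root y)))

  -- Deleting an edge of a cycle does not disconnect anything, so a forest with
  -- a cycle would violate connected-bound.
  forest-acyclic : ∀ {F} → Forest F → Acyclic F
  forest-acyclic {F} Φ v₀ v₁ v₂ vs
    (((_ ∷ n₀₂ ∷ n₀) ∷ (n₁₂ ∷ n₁) ∷ _) , ((e , e∈F , eq) ∷ (j₁₂ ∷ linked))) =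
    ℕ.<⇒≱ (ℕ.+-monoˡ-< (fix (lab Φ)) (x∈p⇒∣p-x∣<∣p∣ e∈F))
      (ℕ.≤-trans (ℕ.≤-reflexive (card Φ)) (connected-bound (lab Φ) (lab-idem Φ) (λ x → (detour ⋆) (path Φ x))))
    where
    step : ∀ {a b} → ¬ (a ≡ v₀ × b ≡ v₁) → ¬ (a ≡ v₁ × b ≡ v₀) → Joined F a b → Joined (F - e) a b
    step {a} {b} ¬01 ¬10 (e′ , e′∈F , eq′) = e′ , x∈p∧x≢y⇒x∈p-y e′∈F (λ { refl → absurd eq eq′ }) , eq′
      where
      absurd : Joins e v₀ v₁ → Joins e a b → Empty
      absurd (inj₁ refl) (inj₁ refl) = ¬01 (refl , refl)
      absurd (inj₁ refl) (inj₂ refl) = ¬10 (refl , refl)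
      absurd (inj₂ refl) (inj₁ refl) = ¬10 (refl , refl)
      absurd (inj₂ refl) (inj₂ refl) = ¬01 (refl , refl)

    -- From `v₂` on, each edge of the cycle starts at a vertex other than `v₀` and `v₁`, hence
    -- differs from `e` and survives its deletion.
    walk : ∀ x xs → All (v₀ ≢_) (x ∷ xs) → All (v₁ ≢_) (x ∷ xs) → Linked (Joined F) (x ∷ xs ∷ʳ v₀) →
           Star (Joined (F - e)) x v₀
    walk x []       (x≢v₀ ∷ _) (x≢v₁ ∷ _) (j ∷ [-])    = step (≢-sym x≢v₀ ∘ proj₁) (≢-sym x≢v₁ ∘ proj₁) j ◅ ε
    walk x (y ∷ xs) (x≢v₀ ∷ p) (x≢v₁ ∷ q) (j ∷ linked) = step (≢-sym x≢v₀ ∘ proj₁) (≢-sym x≢v₁ ∘ proj₁) j ◅ walk y xs p q linked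

    v₁⇝v₀ : Star (Joined (F - e)) v₁ v₀
    v₁⇝v₀ = step (≢-sym n₁₂ ∘ proj₂) (≢-sym n₀₂ ∘ proj₂) j₁₂ ◅ walk v₂ vs (n₀₂ ∷ n₀) (n₁₂ ∷ n₁) linked

    detour : ∀ {a b} → Joined F a b → Star (Joined (F - e)) a b
    detour {a} {b} j with (a ≟V v₀) ×-dec (b ≟V v₁) | (a ≟V v₁) ×-dec (b ≟V v₀)
    ... | yes (refl , refl) | _                 = Star-sym v₁⇝v₀
    ... | no _              | yes (refl , refl) = v₁⇝v₀
    ... | no ¬01            | no ¬10            = step ¬01 ¬10 j ◅ ε

  -- The index lists all vertices including both ends, so that a path whose ends are joined has the
  -- shape required by `IsCycle`.
  data Path (F : EdgeSet) : V → V → List V → Set where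
    [_]  : ∀ v → Path F v v (v ∷ [])
    _∷_  : ∀ {u w v xs} → Joined F u w → Path F w v xs → Path F u v (u ∷ xs)

  suffix : ∀ {F u v x xs} → Path F u v xs → Unique xs → x ∈ˡ xs → ∃[ ys ] Path F x v ys × Unique ys
  suffix p       uq       (here refl) with p
  ... | [ _ ]  = _ , [ _ ] , uq
  ... | j ∷ q  = _ , j ∷ q , uq
  suffix (j ∷ p) (_ ∷ uq) (there x∈)  = suffix p uq x∈

  -- Loop erasure: if the new first vertex already occurs on the simple path, continue from that
  -- occurrence.
  simple : ∀ {F u v} → Star (Joined F) u v → ∃[ xs ] Path F u v xs × Unique xs
  simple ε = _ , [ _ ] , [] ∷ []
  simple {u = u} (j ◅ js) with simple js
  ... | xs , p , uq with Any.any? (u ≟V_) xs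
  ...   | yes u∈xs = suffix p uq u∈xs
  ...   | no u∉xs  = u ∷ xs , j ∷ p , All.¬Any⇒All¬ xs u∉xs ∷ uq

  close : ∀ {F u v w xs} → Path F u v xs → Joined F v w → Linked (Joined F) (xs ∷ʳ w)
  close [ _ ]             k = k ∷ [-]
  close (j ∷ [ _ ])       k = j ∷ close [ _ ] k
  close (j ∷ p@(_ ∷ _))   k = j ∷ close p k

  Path-⊆ : ∀ {F F′ u v xs} → F ⊆ F′ → Path F u v xs → Path F′ u v xs
  Path-⊆ F⊆F′ [ v ]   = [ v ]
  Path-⊆ F⊆F′ (j ∷ p) = Joined-⊆ F⊆F′ j ∷ Path-⊆ F⊆F′ p

  -- A simple path in `F` between the ends of `e` is a single edge, which must be `e` because the
  -- graph is simple, or else it closes with `e` to a cycle in `A`.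
  acyclic-detour : ∀ {A F e u v} → Acyclic A → F ⊆ A → e ∈ A → Joins e u v → Star (Joined F) u v → e ∈ F
  acyclic-detour {A} {F} {e} {u} {v} acyclic F⊆A e∈A joins js with simple js
  ... | _ , [ _ ] , _ = contradiction refl (Joins-≢ joins)
  ... | _ , ((e′ , e′∈F , eq) ∷ [ _ ]) , _ = subst (_∈ F) (edge-unique eq joins) e′∈F
  ... | _ , p@(j ∷ k ∷ [ _ ]) , uq =
    contradiction (uq , close (Path-⊆ F⊆A p) (Joined-sym (e , e∈A , joins))) (acyclic _ _ _ _)
  ... | _ , p@(j ∷ k ∷ _ ∷ _) , uq =
    contradiction (uq , close (Path-⊆ F⊆A p) (Joined-sym (e , e∈A , joins))) (acyclic _ _ _ _)

  -- Any edge of `A` has its ends connected in a maximal forest `F` inside `A`, so `acyclic-detour`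
  -- puts it into `F`. Thus `A` is no larger than `F`, and `g`, constant on the components of `F`,
  -- has no more classes than there are components.
  acyclic-bound : ∀ {A} → Acyclic A → (g : V → V) → (∀ x → g (g x) ≡ g x) → Compatible g A → ∣ A ∣ + fix g ≤ n
  acyclic-bound {A} acyclic g g-idem compat = begin
    ∣ A ∣ + fix g        ≤⟨ ℕ.+-mono-≤ (p⊆q⇒∣p∣≤∣q∣ A⊆F) (fix-≤ (lab-idem forestF) finer) ⟩
    ∣ F ∣ + fix label    ≡⟨ card forestF ⟩
    n                    ∎
    where
    open Spanning A
    open ℕ.≤-Reasoning
    connect : ∀ {x y} → label x ≡ label y → Star (Joined F) x y
    connect {x} {y} eq = subst (Star (Joined F) x) eq (path forestF x) ◅◅ Star-sym (path forestF y)
    finer : ∀ {x y} → label x ≡ label y → g x ≡ g y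
    finer eq = Compatible-Star (λ e e∈F → compat e (F⊆C e∈F)) (connect eq)
    A⊆F : A ⊆ F
    A⊆F {e} e∈A = acyclic-detour acyclic F⊆C e∈A (inj₁ refl) (connect (label-compatible e e∈A))

  Acyclic-⊆ : ∀ {F F′} → F ⊆ F′ → Acyclic F′ → Acyclic F
  Acyclic-⊆ F⊆F′ acyclic v₀ v₁ v₂ vs (uq , linked) = acyclic v₀ v₁ v₂ vs (uq , Linked.map (Joined-⊆ F⊆F′) linked)

-- Rational arithmetic

-- The division by 1 normalises with a gcd that is stuck on a variable `k`; the explicit constructor
-- form computes.
fromℕ-mkℚ : ∀ k → fromℕ k ≡ ℚ.mkℚ (pos k) 0 (Coprimality.sym (Coprimality.1-coprimeTo k))
fromℕ-mkℚ k = ℚ.↥p/↧p≡p (ℚ.mkℚ (pos k) 0 _)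

toℚᵘ-fromℕ : ∀ k → ℚ.toℚᵘ (fromℕ k) ≡ mkℚᵘ (pos k) 0
toℚᵘ-fromℕ k = cong ℚ.toℚᵘ (fromℕ-mkℚ k)

toℚᵘ-/ : ∀ z d .{{_ : NonZero d}} → ℚ.toℚᵘ (z ℚ./ d) ℚᵘ.≃ (z ℚᵘ./ d)
toℚᵘ-/ z (suc d) = ℚ.toℚᵘ-fromℚᵘ (mkℚᵘ z d)

fromℕ-mono : ∀ {a b} → a ≤ b → fromℕ a ℚ.≤ fromℕ b
fromℕ-mono {a} {b} a≤b = subst₂ ℚ._≤_ (sym (fromℕ-mkℚ a)) (sym (fromℕ-mkℚ b))
  (ℚ.*≤* (subst₂ ℤ._≤_ (sym (ℤ.*-identityʳ (pos a))) (sym (ℤ.*-identityʳ (pos b))) (ℤ.+≤+ a≤b)))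

fromℕ-* : ∀ a b → fromℕ (a * b) ≡ fromℕ a ℚ.* fromℕ b
fromℕ-* a b = ℚ.toℚᵘ-injective (begin
  ℚ.toℚᵘ (fromℕ (a * b))                       ≡⟨ toℚᵘ-fromℕ (a * b) ⟩
  mkℚᵘ (pos (a * b)) 0                           ≡⟨ cong (λ z → mkℚᵘ z 0) (ℤ.pos-* a b) ⟩
  mkℚᵘ (pos a) 0 ℚᵘ.* mkℚᵘ (pos b) 0               ≡⟨ cong₂ ℚᵘ._*_ (toℚᵘ-fromℕ a) (toℚᵘ-fromℕ b) ⟨
  ℚ.toℚᵘ (fromℕ a) ℚᵘ.* ℚ.toℚᵘ (fromℕ b)       ≈⟨ ℚ.toℚᵘ-homo-* (fromℕ a) (fromℕ b) ⟨
  ℚ.toℚᵘ (fromℕ a ℚ.* fromℕ b)                 ∎)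
  where open ℚᵘ.≃-Reasoning

0≤fromℕ : ∀ k → ℚ.0ℚ ℚ.≤ fromℕ k
0≤fromℕ k = fromℕ-mono {0} {k} z≤n

module _ (r n : ℕ) .{{_ : NonZero r}} where
  discrepancy : ℕ → ℚ
  discrepancy m = fromℕ r ℚ.* (fromℕ m ℚ.- (pos n ℤ.- pos 1) ℚ./ r)

  discrepancy-mono : ∀ {a b} → a ≤ b → discrepancy a ℚ.≤ discrepancy b
  discrepancy-mono a≤b =
    ℚ.*-monoˡ-≤-nonNeg (fromℕ r) {{ℚ.nonNegative (0≤fromℕ r)}} (ℚ.+-monoˡ-≤ _ (fromℕ-mono a≤b))

-- The discrepancy is r m - (n - 1), and the hypothesis is this equation without subtraction. In
-- unnormalised rationals it becomes a ring identity over the integers.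
discrepancy-fromℕ : ∀ r n m h .{{_ : NonZero r}} → r * m + 1 ≡ n + h → discrepancy r n m ≡ fromℕ h
discrepancy-fromℕ r@(suc r-1) n m h eq = ℚ.toℚᵘ-injective (begin
  ℚ.toℚᵘ (discrepancy r n m)
    ≈⟨ ℚ.toℚᵘ-homo-* (fromℕ r) _ ⟩
  ℚ.toℚᵘ (fromℕ r) ℚᵘ.* ℚ.toℚᵘ (fromℕ m ℚ.- z ℚ./ r)
    ≈⟨ ℚᵘ.*-congˡ {ℚ.toℚᵘ (fromℕ r)} (ℚ.toℚᵘ-homo-+ (fromℕ m) (ℚ.- (z ℚ./ r))) ⟩
  ℚ.toℚᵘ (fromℕ r) ℚᵘ.* (ℚ.toℚᵘ (fromℕ m) ℚᵘ.+ ℚ.toℚᵘ (ℚ.- (z ℚ./ r)))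
    ≈⟨ ℚᵘ.*-congˡ {ℚ.toℚᵘ (fromℕ r)} (ℚᵘ.+-congʳ (ℚ.toℚᵘ (fromℕ m))
         (ℚᵘ.≃-trans (ℚ.toℚᵘ-homo‿- (z ℚ./ r)) (ℚᵘ.-‿cong (toℚᵘ-/ z r)))) ⟩
  ℚ.toℚᵘ (fromℕ r) ℚᵘ.* (ℚ.toℚᵘ (fromℕ m) ℚᵘ.- mkℚᵘ z r-1)
    ≡⟨ cong₂ (λ x y → x ℚᵘ.* (y ℚᵘ.- mkℚᵘ z r-1)) (toℚᵘ-fromℕ r) (toℚᵘ-fromℕ m) ⟩
  mkℚᵘ (pos r) 0 ℚᵘ.* (mkℚᵘ (pos m) 0 ℚᵘ.- mkℚᵘ z r-1)
    ≈⟨ *≡* cross ⟩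
  mkℚᵘ (pos h) 0
    ≡⟨ toℚᵘ-fromℕ h ⟨
  ℚ.toℚᵘ (fromℕ h) ∎)
  where
  open ℚᵘ.≃-Reasoning
  z = pos n ℤ.- pos 1
  eqℤ : pos r ℤ.* pos m ℤ.+ pos 1 ≡ pos n ℤ.+ pos h
  eqℤ = trans (cong (ℤ._+ pos 1) (sym (ℤ.pos-* r m))) (cong pos eq)
  rearrange : ∀ R M N H → R ℤ.* M ℤ.+ pos 1 ≡ N ℤ.+ H →
              R ℤ.* (M ℤ.* R ℤ.+ (ℤ.- (N ℤ.- pos 1)) ℤ.* pos 1) ℤ.* pos 1 ≡ H ℤ.* R
  rearrange R M N H e = trans (lhs R M N) (trans (cong (λ x → R ℤ.* (x ℤ.- N)) e) (rhs R N H))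
    where
    lhs : ∀ R M N → R ℤ.* (M ℤ.* R ℤ.+ (ℤ.- (N ℤ.- pos 1)) ℤ.* pos 1) ℤ.* pos 1 ≡ R ℤ.* ((R ℤ.* M ℤ.+ pos 1) ℤ.- N)
    lhs = ℤ-Solver.solve-∀
    rhs : ∀ R N H → R ℤ.* ((N ℤ.+ H) ℤ.- N) ≡ H ℤ.* R
    rhs = ℤ-Solver.solve-∀
  denominator : pos (1 * (1 * r)) ≡ pos r
  denominator = cong pos (trans (ℕ.*-identityˡ (1 * r)) (ℕ.*-identityˡ r))
  cross : (pos r ℤ.* (pos m ℤ.* pos r ℤ.+ (ℤ.- z) ℤ.* pos 1)) ℤ.* pos 1 ≡ pos h ℤ.* pos (1 * (1 * r))
  cross = trans (rearrange (pos r) (pos m) (pos n) (pos h) eqℤ) (cong (pos h ℤ.*_) (sym denominator))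

private
  module ℚ* = CommutativeSemigroupProperties (CommutativeRing.*-commutativeSemigroup ℚ.+-*-commutativeRing)

square-scale : ∀ c x → (c ℚ.* x) ℚ.* (c ℚ.* x) ≡ (c ℚ.* c) ℚ.* (x ℚ.* x)
square-scale c x = ℚ*.interchange c x c x

fromℕ-squareʰ : ∀ h d → fromℕ (h * h * d) ≡ fromℕ h ℚ.* fromℕ h ℚ.* fromℕ d
fromℕ-squareʰ h d = trans (fromℕ-* (h * h) d) (cong (ℚ._* fromℕ d) (fromℕ-* h h))

upper-ℚ : ∀ K N h d → h * h * d ≤ (K * N) * (K * N) →
          fromℕ h ℚ.* fromℕ h ℚ.* fromℕ d ℚ.≤ (fromℕ K ℚ.* fromℕ N) ℚ.* (fromℕ K ℚ.* fromℕ N)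
upper-ℚ K N h d le = subst₂ ℚ._≤_ (fromℕ-squareʰ h d)
  (trans (fromℕ-* (K * N) (K * N)) (cong₂ ℚ._*_ (fromℕ-* K N) (fromℕ-* K N))) (fromℕ-mono le)

inverse-ℚ : ∀ K .{{_ : NonZero K}} → ((pos 1) ℚ./ K) ℚ.* fromℕ K ≡ ℚ.1ℚ
inverse-ℚ K@(suc k) = ℚ.toℚᵘ-injective (begin
  ℚ.toℚᵘ (((pos 1) ℚ./ K) ℚ.* fromℕ K)            ≈⟨ ℚ.toℚᵘ-homo-* ((pos 1) ℚ./ K) (fromℕ K) ⟩
  ℚ.toℚᵘ ((pos 1) ℚ./ K) ℚᵘ.* ℚ.toℚᵘ (fromℕ K)    ≈⟨ ℚᵘ.*-cong (toℚᵘ-/ (pos 1) K) (ℚᵘ.≃-reflexive (toℚᵘ-fromℕ K)) ⟩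
  mkℚᵘ (pos 1) k ℚᵘ.* mkℚᵘ (pos K) 0                ≈⟨ *≡* (trans (ℤ.*-identityʳ (pos 1 ℤ.* pos K)) (cong (λ x → pos 1 ℤ.* (pos x)) (sym (ℕ.*-identityʳ K)))) ⟩
  ℚᵘ.1ℚᵘ                                        ∎)
  where open ℚᵘ.≃-Reasoning

lower-ℚ : ∀ K N h d .{{_ : NonZero K}} → N * N ≤ (K * K) * (h * h * d) → let c = (pos 1) ℚ./ K in
          (c ℚ.* fromℕ N) ℚ.* (c ℚ.* fromℕ N) ℚ.≤ fromℕ h ℚ.* fromℕ h ℚ.* fromℕ d
lower-ℚ K N h d le = begin
  (c ℚ.* fromℕ N) ℚ.* (c ℚ.* fromℕ N)                    ≡⟨ square-scale c (fromℕ N) ⟩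
  (c ℚ.* c) ℚ.* (fromℕ N ℚ.* fromℕ N)                    ≡⟨ cong ((c ℚ.* c) ℚ.*_) (fromℕ-* N N) ⟨
  (c ℚ.* c) ℚ.* fromℕ (N * N)                            ≤⟨ ℚ.*-monoˡ-≤-nonNeg (c ℚ.* c) {{c²≥0}} (fromℕ-mono le) ⟩
  (c ℚ.* c) ℚ.* fromℕ ((K * K) * (h * h * d))            ≡⟨ cong ((c ℚ.* c) ℚ.*_) (trans (fromℕ-* (K * K) _) (cong₂ ℚ._*_ (fromℕ-* K K) (fromℕ-squareʰ h d))) ⟩
  (c ℚ.* c) ℚ.* ((fromℕ K ℚ.* fromℕ K) ℚ.* H)            ≡⟨ ℚ.*-assoc (c ℚ.* c) _ H ⟨
  ((c ℚ.* c) ℚ.* (fromℕ K ℚ.* fromℕ K)) ℚ.* H            ≡⟨ cong (ℚ._* H) (square-scale c (fromℕ K)) ⟨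
  ((c ℚ.* fromℕ K) ℚ.* (c ℚ.* fromℕ K)) ℚ.* H            ≡⟨ cong (λ x → (x ℚ.* x) ℚ.* H) (inverse-ℚ K) ⟩
  ℚ.1ℚ ℚ.* H                                             ≡⟨ ℚ.*-identityˡ H ⟩
  H                                                      ∎
  where
  open ℚ.≤-Reasoning
  c = (pos 1) ℚ./ K
  H = fromℕ h ℚ.* fromℕ h ℚ.* fromℕ d
  c>0 : ℚ.Positive c
  c>0 = ℚ.normalize-pos 1 K
  c²≥0 : ℚ.NonNegative (c ℚ.* c)
  c²≥0 = ℚ.pos⇒nonNeg (c ℚ.* c) {{ℚ.pos*pos⇒pos c {{c>0}} c {{c>0}}}}

-- The discrepancy as a minimum of maximal colour ranks

max-≤ : ∀ {r} {h : Fin r → ℕ} {c} → (∀ i → h i ≤ c) → max 0 (map h (allFin r)) ≤ c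
max-≤ {r} {h} h≤c = Extrema.max≤v⁺ {xs = map h (allFin r)} z≤n (All.map⁺ (All.tabulate λ {i} _ → h≤c i))

≤-max : ∀ {r} (h : Fin r → ℕ) i → h i ≤ max 0 (map h (allFin r))
≤-max {r} h i = All.lookup (Extrema.xs≤max 0 (map h (allFin r))) (∈-map⁺ h (∈-allFin i))

argmax : ∀ {r} .{{_ : NonZero r}} (h : Fin r → ℕ) → ∃[ i ] (∀ j → h j ≤ h i)
argmax {suc zero}    h = zero , λ { zero → ℕ.≤-refl }
argmax {suc (suc r)} h with argmax (h ∘ suc)
... | i , max with ℕ.≤-total (h zero) (h (suc i))
...   | inj₁ le = suc i , λ { zero → le ; (suc j) → max j }
...   | inj₂ ge = zero  , λ { zero → ℕ.≤-refl ; (suc j) → ℕ.≤-trans (max j) ge }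

argmin : ∀ {r} .{{_ : NonZero r}} (h : Fin r → ℕ) → ∃[ i ] (∀ j → h i ≤ h j)
argmin {suc zero}    h = zero , λ { zero → ℕ.≤-refl }
argmin {suc (suc r)} h with argmin (h ∘ suc)
... | i , min with ℕ.≤-total (h zero) (h (suc i))
...   | inj₁ le = zero  , λ { zero → ℕ.≤-refl ; (suc j) → ℕ.≤-trans le (min j) }
...   | inj₂ ge = suc i , λ { zero → ge ; (suc j) → min j }

-- Colourings are functions; the minimum over them is found on their tables, one entry at a time.
argmin-Vec : ∀ {r} .{{_ : NonZero r}} m (h : Vec (Fin r) m → ℕ) → ∃[ v ] (∀ w → h v ≤ h w)
argmin-Vec zero    h = [] , λ { [] → ℕ.≤-refl }
argmin-Vec (suc m) h =
  let best i    = argmin-Vec m (h ∘ (i ∷_))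
      (i , min) = argmin λ i → h (i ∷ proj₁ (best i))
  in i ∷ proj₁ (best i) , λ { (j ∷ w) → ℕ.≤-trans (min j) (proj₂ (best j) w) }

module Discrepancy {n : ℕ} (r : ℕ) .{{_ : NonZero r}} (G : SimpleGraph n)
                   (connected : ∀ u v → Star (SimpleGraph.Adj G) u v) where
  open Cycle G public
  open Forest
  open Growth

  rank : EdgeSet → ℕ
  rank C = ∣ Spanning.F C ∣

  -- The components of `C` are unions of those of `A`, and both sets of edges are forests. In
  -- particular `rank` does not depend on the forest chosen for it.
  rank-bound : ∀ {A C} → Acyclic A → A ⊆ C → ∣ A ∣ ≤ rank C
  rank-bound {A} {C} acyclic A⊆C = ℕ.+-cancelʳ-≤ (fix label) _ _
    (ℕ.≤-trans (acyclic-bound acyclic label (lab-idem forestF) (λ e e∈A → label-compatible e (A⊆C e∈A)))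
               (ℕ.≤-reflexive (sym (card forestF))))
    where open Spanning C

  spanning-tree : ∀ {F} → Forest F → ∃[ T ] IsSpanningTree T × F ⊆ T
  spanning-tree Φ = grown γ , (connect , forest-acyclic (forest γ)) , extends γ
    where
    γ = grow Φ (allFin (length edges))
    l = lab (forest γ)
    label-adj : ∀ {u v} → Adj u v → l u ≡ l v
    label-adj adj with edge adj
    ... | e , inj₁ refl = absorbs γ e (∈-allFin e)
    ... | e , inj₂ refl = sym (absorbs γ e (∈-allFin e))
    label-star : ∀ {u v} → Star Adj u v → l u ≡ l v
    label-star ε        = refl
    label-star (a ◅ as) = trans (label-adj a) (label-star as)
    connect : Connected (grown γ)
    connect u v = subst (Star (Joined (grown γ)) u) (label-star (connected u v)) (path (forest γ) u)
                  ◅◅ Star-sym (path (forest γ) v)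

  module _ (f : Colouring r G) where
    ∈-class : ∀ {e i} → f e ≡ i → e ∈ colourClass r G f i
    ∈-class {e} {i} eq = Vec.lookup⇒[]= e _ (trans (Vec.lookup∘tabulate _ e) (dec-true (f e Fin.≟ i) eq))

    class-∈ : ∀ {e i} → e ∈ colourClass r G f i → f e ≡ i
    class-∈ {e} {i} e∈ with f e Fin.≟ i | trans (sym (Vec.lookup∘tabulate (λ e → does (f e Fin.≟ i)) e)) (Vec.[]=⇒lookup e∈)
    ... | yes eq | _ = eq

    colour-rank : Fin r → ℕ
    colour-rank i = rank (colourClass r G f i)

    top : Fin r
    top = proj₁ (argmax colour-rank)

    φ : ℕ
    φ = colour-rank top

    colour-rank≤φ : ∀ i → colour-rank i ≤ φ
    colour-rank≤φ = proj₂ (argmax colour-rank)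

    maxColour≤φ : ∀ {T} → Acyclic T → maxColour r G f T ≤ φ
    maxColour≤φ {T} acyclic = max-≤ λ i → ℕ.≤-trans
      (rank-bound (Acyclic-⊆ (λ e∈ → proj₂ (x∈p∩q⁻ (class i) T e∈)) acyclic) (λ e∈ → proj₁ (x∈p∩q⁻ (class i) T e∈)))
      (colour-rank≤φ i)
      where class = colourClass r G f

    φ-attained : ∃[ T ] IsSpanningTree T × maxColour r G f T ≡ φ
    φ-attained with spanning-tree (Spanning.forestF (colourClass r G f top))
    ... | T , tree , F⊆T = T , tree , ℕ.≤-antisym (maxColour≤φ (proj₂ tree)) (ℕ.≤-trans
      (p⊆q⇒∣p∣≤∣q∣ λ e∈F → x∈p∩q⁺ (Spanning.F⊆C (class top) e∈F , F⊆T e∈F))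
      (≤-max (λ i → ∣ class i ∩ T ∣) top))
      where class = colourClass r G f

    φ-isMax : IsMaxTreeDiscrepancy r G f (discrepancy r n φ)
    φ-isMax = (T , tree , cong (discrepancy r n) (sym eq))
            , λ { p (T , tree , refl) → discrepancy-mono r n (maxColour≤φ (proj₂ tree)) }
      where
      T = proj₁ φ-attained
      tree = proj₁ (proj₂ φ-attained)
      eq = proj₂ (proj₂ φ-attained)

  private
    minimiser = argmin-Vec (length edges) (φ ∘ Vec.lookup)

  optimal : Colouring r G
  optimal = Vec.lookup (proj₁ minimiser)

  -- A colouring and its table agree only pointwise, but their colour classes are themselves tables
  -- and hence equal. It suffices to compare the class of the top colour `t` of the table.
  optimal≤ : ∀ f → φ optimal ≤ φ f
  optimal≤ f = ℕ.≤-trans (proj₂ minimiser (Vec.tabulate f))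
    (subst (_≤ φ f) (cong rank (Vec.tabulate-cong λ e → cong (λ c → does (c Fin.≟ t)) (sym (Vec.lookup∘tabulate f e))))
           (colour-rank≤φ f t))
    where t = top (Vec.lookup (Vec.tabulate f))

  isSpanningTreeDiscrepancy : IsSpanningTreeDiscrepancy r G (discrepancy r n (φ optimal))
  isSpanningTreeDiscrepancy =
      (optimal , φ-isMax optimal)
    , λ { p (f , ((T , tree , p≡) , greatest)) → ℚ.≤-trans (discrepancy-mono r n (optimal≤ f))
          (greatest _ (proj₁ (φ-isMax f))) }

  -- A vertex outside `U` meets no edge of `C`, hence is its own label. So at least n - |U|
  -- components are counted by `fix label`.
  rank-cover : ∀ {C} {U : V → Set} (U? : ∀ x → Dec (U x)) → (∀ e → e ∈ C → U (head e) × U (tail e)) →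
               rank C ≤ ∑V (χ ∘ U?)
  rank-cover {C} {U} U? cover = ℕ.+-cancelʳ-≤ (fix label) _ _ (begin
    ∣ F ∣ + fix label                                 ≡⟨ card forestF ⟩
    n                                                 ≡⟨ trans (sum-const n 1) (ℕ.*-identityʳ n) ⟨
    sum {n} (λ _ → 1)                                 ≤⟨ sum-mono (λ i → covered (nth i)) ⟩
    sum (λ i → χ (U? (nth i)) + χ (label (nth i) ≟V nth i))
                                                      ≡⟨ ∑-distrib-+ (λ i → χ (U? (nth i))) (λ i → χ (label (nth i) ≟V nth i)) ⟩
    ∑V (χ ∘ U?) + fix label                           ∎)
    where
    open Spanning C
    open ℕ.≤-Reasoning
    touched : ∀ {x y} → Star (Joined F) x y → y ≡ x ⊎ U x
    touched ε                              = inj₁ refl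
    touched ((e , e∈F , inj₁ refl) ◅ _) = inj₂ (proj₁ (cover e (F⊆C e∈F)))
    touched ((e , e∈F , inj₂ refl) ◅ _) = inj₂ (proj₂ (cover e (F⊆C e∈F)))
    covered : ∀ x → 1 ≤ χ (U? x) + χ (label x ≟V x)
    covered x = case touched (path forestF x) of λ
      { (inj₁ eq) → ℕ.≤-trans (ℕ.≤-reflexive (sym (χ-yes (label x ≟V x) eq))) (ℕ.m≤n+m _ _)
      ; (inj₂ u)  → ℕ.≤-trans (ℕ.≤-reflexive (sym (χ-yes (U? x) u))) (ℕ.m≤m+n _ _) }

-- Vertex isoperimetry in the hypercube

flip : ∀ {d} → Fin d → Vec Bool d → Vec Bool d
flip zero    (b ∷ v) = not b ∷ v
flip (suc j) (b ∷ v) = b ∷ flip j v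

flip-involutive : ∀ {d} (j : Fin d) v → flip j (flip j v) ≡ v
flip-involutive zero    (b ∷ v) = cong (_∷ v) (not-involutive b)
flip-involutive (suc j) (b ∷ v) = cong (b ∷_) (flip-involutive j v)

DifferInOne-tail : ∀ {d} b {u v : Vec Bool d} → DifferInOne u v → DifferInOne (b ∷ u) (b ∷ v)
DifferInOne-tail b (i , i≢ , unique) =
  suc i , i≢ , λ { {zero} b≢b → contradiction refl b≢b ; {suc j} j≢ → cong suc (unique j≢) }

DifferInOne-head : ∀ {d a b} {v : Vec Bool d} → a ≢ b → DifferInOne (a ∷ v) (b ∷ v)
DifferInOne-head a≢b = zero , a≢b , λ { {zero} _ → refl ; {suc j} j≢ → contradiction refl j≢ }

flip-adj : ∀ {d} (j : Fin d) v → DifferInOne v (flip j v)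
flip-adj zero    (b ∷ v) = DifferInOne-head (not-¬ refl)
flip-adj (suc j) (b ∷ v) = DifferInOne-tail b (flip-adj j v)

lookup-ext : ∀ {d} (u v : Vec Bool d) → (∀ i → lookupᵛ u i ≡ lookupᵛ v i) → u ≡ v
lookup-ext []      []      _  = refl
lookup-ext (_ ∷ u) (_ ∷ v) eq = cong₂ _∷_ (eq zero) (lookup-ext u v (eq ∘ suc))

≢⇒not : ∀ {a b} → a ≢ b → b ≡ not a
≢⇒not {false} {false} a≢b = contradiction refl a≢b
≢⇒not {false} {true}  a≢b = refl
≢⇒not {true}  {false} a≢b = refl
≢⇒not {true}  {true}  a≢b = contradiction refl a≢b

adj-flip : ∀ {d} {u v : Vec Bool d} → DifferInOne u v → ∃[ j ] v ≡ flip j u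
adj-flip {u = a ∷ u} {b ∷ v} (zero , a≢b , unique) = zero , cong₂ _∷_ (≢⇒not a≢b)
  (sym (lookup-ext u v λ i → case lookupᵛ u i Bool.≟ lookupᵛ v i of λ
    { (yes eq) → eq ; (no ≢) → case unique {suc i} ≢ of λ () }))
adj-flip {u = a ∷ u} {b ∷ v} (suc i , i≢ , unique) with a Bool.≟ b
... | no a≢b  = case unique {zero} a≢b of λ ()
... | yes refl with adj-flip {u = u} {v} (i , i≢ , λ j≢ → Fin.suc-injective (unique j≢))
...   | j , v≡ = suc j , cong (a ∷_) v≡

Q-connected : ∀ {d} (u v : Vec Bool d) → Star DifferInOne u v
Q-connected []      []      = ε
Q-connected (a ∷ u) (b ∷ v) with a Bool.≟ b
... | yes refl = Star.gmap (a ∷_) (DifferInOne-tail a) (Q-connected u v)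
... | no a≢b   = DifferInOne-head a≢b ◅ Star.gmap (b ∷_) (DifferInOne-tail b) (Q-connected u v)

∑Q : ∀ d → (Vec Bool d → ℕ) → ℕ
∑Q d = Graph.∑V (Q d)

∑Q-split : ∀ d (h : Vec Bool (suc d) → ℕ) → ∑Q (suc d) h ≡ ∑Q d (h ∘ (false ∷_)) + ∑Q d (h ∘ (true ∷_))
∑Q-split d h = begin
  sum f                ≡⟨ sum-↑ (2 ^ d) f ⟩
  sum lower + sum rest ≡⟨ cong (sum lower +_) (trans (sum-↑ (2 ^ d) rest) (ℕ.+-identityʳ _)) ⟩
  sum lower + sum upper
    ≡⟨ cong₂ _+_ (sum-cong-≗ (λ i → cong h (half zero i))) (sum-cong-≗ (λ i → cong h (half (suc zero) i))) ⟩
  ∑Q d (h ∘ (false ∷_)) + ∑Q d (h ∘ (true ∷_)) ∎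
  where
  open ≡-Reasoning
  f : Fin (2 ^ suc d) → ℕ
  f i = h (Inverse.to (Fin2^↔Vec (suc d)) i)
  lower upper : Fin (2 ^ d) → ℕ
  lower i = f (Fin.combine {2} zero i)
  upper i = f (Fin.combine {2} (suc zero) i)
  rest : Fin (2 ^ d + 0) → ℕ
  rest i = f (2 ^ d ↑ʳ i)
  half : ∀ (b : Fin 2) i → Inverse.to (Fin2^↔Vec (suc d)) (Fin.combine b i)
                         ≡ Inverse.to Fin.2↔Bool b ∷ Inverse.to (Fin2^↔Vec d) i
  half b i = cong (λ (b , i) → Inverse.to Fin.2↔Bool b ∷ Inverse.to (Fin2^↔Vec d) i) (Fin.remQuot-combine b i)

∑Q-mono : ∀ d {f g : Vec Bool d → ℕ} → (∀ v → f v ≤ g v) → ∑Q d f ≤ ∑Q d g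
∑Q-mono d f≤g = sum-mono λ i → f≤g (Graph.nth (Q d) i)

∑Q-cong : ∀ d {f g : Vec Bool d → ℕ} → (∀ v → f v ≡ g v) → ∑Q d f ≡ ∑Q d g
∑Q-cong d f≡g = sum-cong-≗ λ i → f≡g (Graph.nth (Q d) i)

square-≤ : ∀ {x y} → x * x ≤ y * y → x ≤ y
square-≤ {x} {y} x²≤y² with x ≤? y
... | yes x≤y = x≤y
... | no x≰y  = contradiction x²≤y² (ℕ.<⇒≱ (ℕ.*-mono-< (ℕ.≰⇒> x≰y) (ℕ.≰⇒> x≰y)))

4ab≤[a+b]² : ∀ a b → 4 * (a * b) ≤ (a + b) * (a + b)
4ab≤[a+b]² a b with ℕ.≤-total a b
... | inj₁ a≤b = subst (λ b → 4 * (a * b) ≤ (a + b) * (a + b)) (ℕ.m+[n∸m]≡n a≤b) (ordered a (b ∸ a))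
  where
  expand : ∀ a t → (a + (a + t)) * (a + (a + t)) ≡ 4 * (a * (a + t)) + t * t
  expand = solve-∀
  ordered : ∀ a t → 4 * (a * (a + t)) ≤ (a + (a + t)) * (a + (a + t))
  ordered a t = subst (4 * (a * (a + t)) ≤_) (sym (expand a t)) (ℕ.m≤m+n _ _)
... | inj₂ b≤a = subst (λ a → 4 * (a * b) ≤ (a + b) * (a + b)) (ℕ.m+[n∸m]≡n b≤a) (ordered b (a ∸ b))
  where
  expand : ∀ b t → ((b + t) + b) * ((b + t) + b) ≡ 4 * ((b + t) * b) + t * t
  expand = solve-∀
  ordered : ∀ b t → 4 * ((b + t) * b) ≤ ((b + t) + b) * ((b + t) + b)
  ordered b t = subst (4 * ((b + t) * b) ≤_) (sym (expand b t)) (ℕ.m≤m+n _ _)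

-- When the two halves of A have nearly equal size, the isoperimetric inequalities
-- of the halves suffice; when their sizes differ by a large δ, so does the size of
-- the neighbourhood, because each half of it contains a copy of the other half of A.
module HalfCubes (M w a δ c b₀ b₁ : ℕ) (large : suc w * (suc w * suc w) ≤ 4 * (M * M))
                 (⊆₀ : a + δ ≤ b₀) (⊆₁ : a + δ ≤ b₁) where
  private
    -- The set A has `a + δ` and `a` points in the two half cubes of size `N`, with complements `c`
    -- and `δ + c`. `X` is |A| times the size of its complement in the whole cube, `Y` twice the sum
    -- of the same products in the halves.
    N = a + δ + c
    X = (a + δ + a) * (c + (δ + c))
    Y = 2 * ((a + δ) * c + a * (δ + c))

    X≡ : X ≡ Y + δ * δ
    X≡ = solve a δ c
      where
      solve : ∀ a δ c → (a + δ + a) * (c + (δ + c)) ≡ 2 * ((a + δ) * c + a * (δ + c)) + δ * δ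
      solve = solve-∀

    X≤N² : X ≤ N * N
    X≤N² = subst₂ _≤_ (sym (left a δ c)) (sym (right a δ c)) (ℕ.+-monoˡ-≤ _ (4ab≤[a+b]² a c))
      where
      left : ∀ a δ c → (a + δ + a) * (c + (δ + c)) ≡ 4 * (a * c) + (2 * (δ * (a + c)) + δ * δ)
      left = solve-∀
      right : ∀ a δ c → (a + δ + c) * (a + δ + c) ≡ (a + c) * (a + c) + (2 * (δ * (a + c)) + δ * δ)
      right = solve-∀

    -- Passing to the halves loses δ² in the product; the unit by which the coefficient drops from
    -- `suc w` to `w` pays for it.
    balanced : suc w * (δ * δ) ≤ X → X * w ≤ Y * suc w
    balanced le = ℕ.+-cancelʳ-≤ X _ _ (begin
      X * w + X                        ≡⟨ trans (ℕ.+-comm (X * w) X) (sym (ℕ.*-suc X w)) ⟩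
      X * suc w                        ≡⟨ cong (_* suc w) X≡ ⟩
      (Y + δ * δ) * suc w              ≡⟨ ℕ.*-distribʳ-+ (suc w) Y (δ * δ) ⟩
      Y * suc w + δ * δ * suc w        ≡⟨ cong (Y * suc w +_) (ℕ.*-comm (δ * δ) (suc w)) ⟩
      Y * suc w + suc w * (δ * δ)      ≤⟨ ℕ.+-monoʳ-≤ (Y * suc w) le ⟩
      Y * suc w + X                    ∎)
      where open ℕ.≤-Reasoning

    -- After squaring, one factor `X` is bounded by N² and the other by the case hypothesis. The
    -- result has `suc w` to the third power, which is the origin of the condition `large`.
    unbalanced : X ≤ suc w * (δ * δ) → X * w ≤ M * (N + N) * δ
    unbalanced le = square-≤ (begin
      X * w * (X * w)                                 ≡⟨ shuffle₁ X w ⟩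
      X * X * (w * w)                                 ≤⟨ ℕ.*-mono-≤ (ℕ.*-mono-≤ X≤N² le) (ℕ.*-mono-≤ (ℕ.n≤1+n w) (ℕ.n≤1+n w)) ⟩
      N * N * (suc w * (δ * δ)) * (suc w * suc w)     ≡⟨ shuffle₂ N (suc w) δ ⟩
      N * N * (δ * δ) * (suc w * (suc w * suc w))     ≤⟨ ℕ.*-monoʳ-≤ (N * N * (δ * δ)) large ⟩
      N * N * (δ * δ) * (4 * (M * M))                 ≡⟨ shuffle₃ N δ M ⟩
      M * (N + N) * δ * (M * (N + N) * δ)             ∎)
      where
      open ℕ.≤-Reasoning
      shuffle₁ : ∀ X w → X * w * (X * w) ≡ X * X * (w * w)
      shuffle₁ = solve-∀
      shuffle₂ : ∀ N v δ → N * N * (v * (δ * δ)) * (v * v) ≡ N * N * (δ * δ) * (v * (v * v))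
      shuffle₂ = solve-∀
      shuffle₃ : ∀ N δ M → N * N * (δ * δ) * (4 * (M * M)) ≡ M * (N + N) * δ * (M * (N + N) * δ)
      shuffle₃ = solve-∀

  step : M * N * (a + δ) + (a + δ) * c * suc w ≤ M * N * b₀ →
         M * N * a + a * (δ + c) * suc w ≤ M * N * b₁ →
         M * (N + N) * (a + δ + a) + X * w ≤ M * (N + N) * (b₀ + b₁)
  step h₀ h₁ with suc w * (δ * δ) ≤? X
  ... | yes le = begin
    M * (N + N) * (a + δ + a) + X * w        ≤⟨ ℕ.+-monoʳ-≤ _ (balanced le) ⟩
    M * (N + N) * (a + δ + a) + Y * suc w    ≡⟨ shuffle M N a δ c (suc w) ⟩
    2 * ((M * N * (a + δ) + (a + δ) * c * suc w) + (M * N * a + a * (δ + c) * suc w))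
                                             ≤⟨ ℕ.*-monoʳ-≤ 2 (ℕ.+-mono-≤ h₀ h₁) ⟩
    2 * (M * N * b₀ + M * N * b₁)            ≡⟨ collect M N b₀ b₁ ⟩
    M * (N + N) * (b₀ + b₁)                  ∎
    where
    open ℕ.≤-Reasoning
    shuffle : ∀ M N a δ c v → M * (N + N) * (a + δ + a) + 2 * ((a + δ) * c + a * (δ + c)) * v
                            ≡ 2 * ((M * N * (a + δ) + (a + δ) * c * v) + (M * N * a + a * (δ + c) * v))
    shuffle = solve-∀
    collect : ∀ M N b₀ b₁ → 2 * (M * N * b₀ + M * N * b₁) ≡ M * (N + N) * (b₀ + b₁)
    collect = solve-∀
  ... | no ≰ = begin
    M * (N + N) * (a + δ + a) + X * w                  ≤⟨ ℕ.+-monoʳ-≤ _ (unbalanced (ℕ.<⇒≤ (ℕ.≰⇒> ≰))) ⟩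
    M * (N + N) * (a + δ + a) + M * (N + N) * δ        ≡⟨ shuffle (M * (N + N)) a δ ⟩
    M * (N + N) * ((a + δ) + (a + δ))                  ≤⟨ ℕ.*-monoʳ-≤ (M * (N + N)) (ℕ.+-mono-≤ ⊆₀ ⊆₁) ⟩
    M * (N + N) * (b₀ + b₁)                            ∎
    where
    open ℕ.≤-Reasoning
    shuffle : ∀ K a δ → K * (a + δ + a) + K * δ ≡ K * ((a + δ) + (a + δ))
    shuffle = solve-∀

halfCubes : ∀ M w N a₀ c₀ a₁ c₁ b₀ b₁ → suc w * (suc w * suc w) ≤ 4 * (M * M) →
            a₀ + c₀ ≡ N → a₁ + c₁ ≡ N → a₀ ≤ b₀ → a₁ ≤ b₀ → a₀ ≤ b₁ → a₁ ≤ b₁ →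
            M * N * a₀ + a₀ * c₀ * suc w ≤ M * N * b₀ →
            M * N * a₁ + a₁ * c₁ * suc w ≤ M * N * b₁ →
            M * (N + N) * (a₀ + a₁) + (a₀ + a₁) * (c₀ + c₁) * w ≤ M * (N + N) * (b₀ + b₁)
halfCubes M w N a₀ c₀ a₁ c₁ b₀ b₁ large eq₀ eq₁ a₀≤b₀ a₁≤b₀ a₀≤b₁ a₁≤b₁ h₀ h₁ with ℕ.≤-total a₁ a₀
... | inj₁ a₁≤a₀ with ℕ.m≤n⇒∃[o]m+o≡n a₁≤a₀
...   | δ , refl with ℕ.+-cancelˡ-≡ a₁ _ _ (trans (trans eq₁ (sym eq₀)) (ℕ.+-assoc a₁ δ c₀)) | eq₀
...     | refl | refl = HalfCubes.step M w a₁ δ c₀ b₀ b₁ large a₀≤b₀ a₀≤b₁ h₀ h₁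
halfCubes M w N a₀ c₀ a₁ c₁ b₀ b₁ large eq₀ eq₁ a₀≤b₀ a₁≤b₀ a₀≤b₁ a₁≤b₁ h₀ h₁
    | inj₂ a₀≤a₁ with ℕ.m≤n⇒∃[o]m+o≡n a₀≤a₁
...   | δ , refl with ℕ.+-cancelˡ-≡ a₀ _ _ (trans (trans eq₀ (sym eq₁)) (ℕ.+-assoc a₀ δ c₁)) | eq₁
...     | refl | refl = subst₂ _≤_
  (cong₂ (λ x y → M * (N + N) * x + y * w) (ℕ.+-comm a₁ a₀) (cong₂ _*_ (ℕ.+-comm a₁ a₀) (ℕ.+-comm c₁ c₀)))
  (cong (M * (N + N) *_) (ℕ.+-comm b₁ b₀))
  (HalfCubes.step M w a₀ δ c₁ b₁ b₀ large a₁≤b₁ a₁≤b₀ h₁ h₀)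

size : ∀ d {A : Vec Bool d → Set} → (∀ v → Dec (A v)) → ℕ
size d A? = ∑Q d (χ ∘ A?)

size≤2^ : ∀ d {A : Vec Bool d → Set} (A? : ∀ v → Dec (A v)) → size d A? ≤ 2 ^ d
size≤2^ d A? = ℕ.≤-trans (sum-mono {2 ^ d} λ i → χ≤1 (A? _)) (ℕ.≤-reflexive (trans (sum-const (2 ^ d) 1) (ℕ.*-identityʳ _)))

size-⊆ : ∀ d {A B : Vec Bool d → Set} (A? : ∀ v → Dec (A v)) (B? : ∀ v → Dec (B v)) → (∀ v → A v → B v) → size d A? ≤ size d B?
size-⊆ d A? B? A⊆B = ∑Q-mono d λ v → χ-mono (A? v) (B? v) (A⊆B v)

-- The coefficient w shrinks as the dimension grows: each induction step spends
-- one unit of it.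
neighbourhood-bound : ∀ M K → K * (K * K) ≤ 4 * (M * M) → ∀ k w → k + w ≡ K →
  {A B : Vec Bool k → Set} (A? : ∀ v → Dec (A v)) (B? : ∀ v → Dec (B v)) →
  (∀ v → A v → B v) → (∀ j v → A v → B (flip j v)) → ∀ c → size k A? + c ≡ 2 ^ k →
  M * 2 ^ k * size k A? + size k A? * c * w ≤ M * 2 ^ k * size k B?
neighbourhood-bound M K large zero w _ A? B? A⊆B _ c eq = begin
  M * 1 * size 0 A? + size 0 A? * c * w ≡⟨ cong (λ x → M * 1 * size 0 A? + x * w) ac≡0 ⟩
  M * 1 * size 0 A? + 0                 ≡⟨ ℕ.+-identityʳ _ ⟩
  M * 1 * size 0 A?                     ≤⟨ ℕ.*-monoʳ-≤ (M * 1) (size-⊆ 0 A? B? A⊆B) ⟩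
  M * 1 * size 0 B?                     ∎
  where
  open ℕ.≤-Reasoning
  -- In a cube with a single point, a set or its complement is empty.
  product-zero : ∀ a c → a + c ≡ 1 → a * c ≡ 0
  product-zero zero          c    _  = refl
  product-zero (suc zero)    zero _  = refl
  product-zero (suc (suc a)) c    ()
  ac≡0 : size 0 A? * c ≡ 0
  ac≡0 = product-zero (size 0 A?) c eq
neighbourhood-bound M K large (suc k) w k+w≡K {A} {B} A? B? A⊆B closed c eq =
  subst₂ _≤_ (cong₂ _+_ (cong₂ (λ x y → M * x * y) double (sym split-A)) (cong₂ (λ x y → x * y * w) (sym split-A) split-c))
             (cong₂ (λ x y → M * x * y) double (sym split-B))
    (halfCubes M w N (a false) (c′ false) (a true) (c′ true) (b false) (b true) cube
      (complement false) (complement true)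
      (inside-half false) (across false) (across true) (inside-half true)
      (half false) (half true))
  where
  N = 2 ^ k
  a b c′ : Bool → ℕ
  a x = size k (A? ∘ (x ∷_))
  b x = size k (B? ∘ (x ∷_))
  c′ x = N ∸ a x
  complement : ∀ x → a x + c′ x ≡ N
  complement x = ℕ.m+[n∸m]≡n (size≤2^ k (A? ∘ (x ∷_)))
  double : N + N ≡ 2 ^ suc k
  double = cong (N +_) (sym (ℕ.+-identityʳ N))
  split-A : size (suc k) A? ≡ a false + a true
  split-A = ∑Q-split k (χ ∘ A?)
  split-B : size (suc k) B? ≡ b false + b true
  split-B = ∑Q-split k (χ ∘ B?)
  rearrange : ∀ p q s t → (p + q) + (s + t) ≡ (p + s) + (q + t)
  rearrange = solve-∀
  split-c : c′ false + c′ true ≡ c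
  split-c = ℕ.+-cancelˡ-≡ (a false + a true) _ _ (begin
    (a false + a true) + (c′ false + c′ true)   ≡⟨ rearrange (a false) (a true) _ _ ⟩
    (a false + c′ false) + (a true + c′ true)   ≡⟨ cong₂ _+_ (complement false) (complement true) ⟩
    N + N                                       ≡⟨ double ⟩
    2 ^ suc k                                   ≡⟨ eq ⟨
    size (suc k) A? + c                         ≡⟨ cong (_+ c) split-A ⟩
    (a false + a true) + c                      ∎)
    where open ≡-Reasoning
  cube : suc w * (suc w * suc w) ≤ 4 * (M * M)
  cube = ℕ.≤-trans (ℕ.*-mono-≤ w<K (ℕ.*-mono-≤ w<K w<K)) large
    where
    w<K : suc w ≤ K
    w<K = subst (suc w ≤_) k+w≡K (s≤s (ℕ.m≤n+m w k))
  inside-half : ∀ x → a x ≤ b x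
  inside-half x = size-⊆ k (A? ∘ (x ∷_)) (B? ∘ (x ∷_)) λ v → A⊆B (x ∷ v)
  across : ∀ x → a (not x) ≤ b x
  across x = size-⊆ k (A? ∘ (not x ∷_)) (B? ∘ (x ∷_)) λ v p → subst (λ y → B (y ∷ v)) (not-involutive x) (closed zero (not x ∷ v) p)
  half : ∀ x → M * N * a x + a x * c′ x * suc w ≤ M * N * b x
  half x = neighbourhood-bound M K large k (suc w) (trans (ℕ.+-suc k w) k+w≡K) (A? ∘ (x ∷_)) (B? ∘ (x ∷_))
    (λ v → A⊆B (x ∷ v)) (λ j v → closed (suc j) (x ∷ v)) (c′ x) (complement x)

-- Starting the coefficient at `K = 2d` leaves `d` after `d` dimensions. The cubic condition needs
-- `M` of order d√d, and `M = 8 d s` meets it with room to spare; the gain d/M is then 1/(8s).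
isoperimetry : ∀ d s .{{_ : NonZero d}} → d ≤ s * s →
  {A B : Vec Bool d → Set} (A? : ∀ v → Dec (A v)) (B? : ∀ v → Dec (B v)) →
  (∀ v → A v → B v) → (∀ j v → A v → B (flip j v)) → ∀ c → size d A? + c ≡ 2 ^ d →
  8 * s * 2 ^ d * size d A? + size d A? * c ≤ 8 * s * 2 ^ d * size d B?
isoperimetry d s d≤s² A? B? A⊆B closed c eq = ℕ.*-cancelʳ-≤ _ _ d (subst₂ _≤_
  (left d s (2 ^ d) (size d A?) c) (right d s (2 ^ d) (size d B?))
  (neighbourhood-bound (8 * d * s) (d + d) large d d refl A? B? A⊆B closed c eq))
  where
  left : ∀ d s N a c → 8 * d * s * N * a + a * c * d ≡ (8 * s * N * a + a * c) * d
  left = solve-∀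
  right : ∀ d s N b → 8 * d * s * N * b ≡ 8 * s * N * b * d
  right = solve-∀
  expand : ∀ d → (d + d) * ((d + d) * (d + d)) ≡ 8 * (d * d) * d
  expand = solve-∀
  collect : ∀ d s → 256 * (d * d) * (s * s) ≡ 4 * (8 * d * s * (8 * d * s))
  collect = solve-∀
  large : (d + d) * ((d + d) * (d + d)) ≤ 4 * (8 * d * s * (8 * d * s))
  large = subst₂ _≤_ (sym (expand d)) (collect d s)
    (ℕ.*-mono-≤ (ℕ.*-monoˡ-≤ (d * d) {8} {256} (ℕ.m≤m+n 8 248)) d≤s²)

-- Sizes of the layers

weight : ∀ {d} → Vec Bool d → ℕ
weight []          = 0
weight (false ∷ v) = weight v
weight (true ∷ v)  = suc (weight v)

weight≤d : ∀ {d} (v : Vec Bool d) → weight v ≤ d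
weight≤d []          = z≤n
weight≤d (false ∷ v) = ℕ.m≤n⇒m≤1+n (weight≤d v)
weight≤d (true ∷ v)  = s≤s (weight≤d v)

weight-flip : ∀ {d} (j : Fin d) v → weight (flip j v) ≡ suc (weight v) ⊎ weight v ≡ suc (weight (flip j v))
weight-flip zero    (false ∷ v) = inj₁ refl
weight-flip zero    (true ∷ v)  = inj₂ refl
weight-flip (suc j) (false ∷ v) = weight-flip j v
weight-flip (suc j) (true ∷ v)  = Sum.map (cong suc) (cong suc) (weight-flip j v)

-- The binomial coefficient d over w, defined as a count so that it applies to vertex sets directly.
layer : ℕ → ℕ → ℕ
layer d w = size d (λ v → weight v ℕ.≟ w)

layer-zero : ∀ d → layer d 0 ≡ 1
layer-zero zero    = cong (_+ 0) (χ-yes (0 ℕ.≟ 0) refl)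
layer-zero (suc d) = trans (∑Q-split d (λ v → χ (weight v ℕ.≟ 0)))
  (cong₂ _+_ (layer-zero d) (sum-zero {2 ^ d} λ i → χ-no (suc (weight (Graph.nth (Q d) i)) ℕ.≟ 0) λ ()))

layer-empty : ∀ w → layer 0 (suc w) ≡ 0
layer-empty w = cong (_+ 0) (χ-no (0 ℕ.≟ suc w) λ ())

layer-suc : ∀ d w → layer (suc d) (suc w) ≡ layer d (suc w) + layer d w
layer-suc d w = trans (∑Q-split d (λ v → χ (weight v ℕ.≟ suc w)))
  (cong (layer d (suc w) +_) (∑Q-cong d λ v →
    χ-cong (suc (weight v) ℕ.≟ suc w) (weight v ℕ.≟ w) ℕ.suc-injective (cong suc)))

-- The identity (k+1) C(d,k+1) = (d-k) C(d,k), free of subtraction and therefore valid for k > d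
-- too; induction by Pascal's rule.
layer-absorption : ∀ d k → suc k * layer d (suc k) + k * layer d k ≡ d * layer d k
layer-absorption zero    zero    = cong (λ x → x + 0 + 0) (layer-empty 0)
layer-absorption zero    (suc k) = trans
  (cong₂ (λ x y → suc (suc k) * x + suc k * y) (layer-empty (suc k)) (layer-empty k))
  (cong₂ _+_ (ℕ.*-zeroʳ (suc (suc k))) (ℕ.*-zeroʳ (suc k)))
layer-absorption (suc d) zero = begin
  1 * layer (suc d) 1 + 0               ≡⟨ cong (λ x → 1 * x + 0) (layer-suc d 0) ⟩
  1 * (layer d 1 + layer d 0) + 0       ≡⟨ regroup (layer d 1) (layer d 0) ⟩
  layer d 0 + (1 * layer d 1 + 0)       ≡⟨ cong₂ _+_ (same d) (layer-absorption d 0) ⟩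
  layer (suc d) 0 + d * layer d 0       ≡⟨ cong (λ x → layer (suc d) 0 + d * x) (same d) ⟩
  suc d * layer (suc d) 0               ∎
  where
  open ≡-Reasoning
  same : ∀ d → layer d 0 ≡ layer (suc d) 0
  same d = trans (layer-zero d) (sym (layer-zero (suc d)))
  regroup : ∀ a b → 1 * (a + b) + 0 ≡ b + (1 * a + 0)
  regroup = solve-∀
layer-absorption (suc d) (suc k) = begin
  suc (suc k) * layer (suc d) (suc (suc k)) + suc k * layer (suc d) (suc k)
    ≡⟨ cong₂ (λ x y → suc (suc k) * x + suc k * y) (layer-suc d (suc k)) (layer-suc d k) ⟩
  suc (suc k) * (layer d (suc (suc k)) + b) + suc k * (b + a)
    ≡⟨ regroup k (layer d (suc (suc k))) b a ⟩
  (suc (suc k) * layer d (suc (suc k)) + suc k * b) + (suc k * b + k * a) + (b + a)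
    ≡⟨ cong₂ (λ x y → x + y + (b + a)) (layer-absorption d (suc k)) (layer-absorption d k) ⟩
  d * b + d * a + (b + a)
    ≡⟨ collect d a b ⟩
  suc d * (b + a)
    ≡⟨ cong (suc d *_) (layer-suc d k) ⟨
  suc d * layer (suc d) (suc k) ∎
  where
  open ≡-Reasoning
  a = layer d k
  b = layer d (suc k)
  regroup : ∀ k c b a → (2 + k) * (c + b) + (1 + k) * (b + a) ≡ ((2 + k) * c + (1 + k) * b) + ((1 + k) * b + k * a) + (b + a)
  regroup = solve-∀
  collect : ∀ d a b → d * b + d * a + (b + a) ≡ (1 + d) * (b + a)
  collect = solve-∀

-- By absorption, consecutive layers have ratio (d-k)/(k+1), which is at least 1 as long as 2k+1 ≤
-- d.
layer-ascending : ∀ d k → suc (k + k) ≤ d → layer d k ≤ layer d (suc k)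
layer-ascending d k le = ℕ.*-cancelˡ-≤ (suc k) (ℕ.+-cancelʳ-≤ (k * layer d k) _ _ (begin
  suc k * layer d k + k * layer d k          ≡⟨ ℕ.*-distribʳ-+ (layer d k) (suc k) k ⟨
  suc (k + k) * layer d k                    ≤⟨ ℕ.*-monoˡ-≤ (layer d k) le ⟩
  d * layer d k                              ≡⟨ layer-absorption d k ⟨
  suc k * layer d (suc k) + k * layer d k    ∎))
  where open ℕ.≤-Reasoning

layer-descending : ∀ d k → d ≤ suc (k + k) → layer d (suc k) ≤ layer d k
layer-descending d k le = ℕ.*-cancelˡ-≤ (suc k) (ℕ.+-cancelʳ-≤ (k * layer d k) _ _ (begin
  suc k * layer d (suc k) + k * layer d k    ≡⟨ layer-absorption d k ⟩
  d * layer d k                              ≤⟨ ℕ.*-monoˡ-≤ (layer d k) le ⟩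
  suc (k + k) * layer d k                    ≡⟨ ℕ.*-distribʳ-+ (layer d k) (suc k) k ⟩
  suc k * layer d k + k * layer d k          ∎))
  where open ℕ.≤-Reasoning

central : ℕ → ℕ
central m = layer (m + m) m

layer≤central : ∀ m k → layer (m + m) k ≤ central m
layer≤central m k with ℕ.≤-total k m
... | inj₁ k≤m = below k (m ∸ k) (trans (ℕ.+-comm k _) (ℕ.m∸n+n≡m k≤m))
  where
  below : ∀ k j → k + j ≡ m → layer (m + m) k ≤ central m
  below k zero    eq = ℕ.≤-reflexive (cong (layer (m + m)) (trans (sym (ℕ.+-identityʳ k)) eq))
  below k (suc j) eq = ℕ.≤-trans (layer-ascending (m + m) k (ℕ.+-mono-≤ k<m (ℕ.<⇒≤ k<m)))
                                 (below (suc k) j (trans (sym (ℕ.+-suc k j)) eq))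
    where
    k<m : k < m
    k<m = subst (k <_) eq (ℕ.m<m+n k (s≤s z≤n))
... | inj₂ m≤k = subst (λ k → layer (m + m) k ≤ central m) (ℕ.m+[n∸m]≡n m≤k) (above (k ∸ m))
  where
  above : ∀ j → layer (m + m) (m + j) ≤ central m
  above zero    = ℕ.≤-reflexive (cong (layer (m + m)) (ℕ.+-identityʳ m))
  above (suc j) = ℕ.≤-trans (subst (λ k → layer (m + m) k ≤ layer (m + m) (m + j)) (sym (ℕ.+-suc m j))
    (layer-descending (m + m) (m + j) (ℕ.m≤n⇒m≤1+n (ℕ.+-mono-≤ (ℕ.m≤m+n m j) (ℕ.m≤m+n m j))))) (above j)

-- Pascal's rule splits the central layer into the two middle layers of dimension 2m+1, which are
-- equal; splitting once more leads back to dimension 2m, where absorption applies.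
central-suc : ∀ m → suc m * central (suc m) ≡ 2 * (suc (m + m) * central m)
central-suc m = begin
  suc m * layer (suc m + suc m) (suc m)         ≡⟨ cong (λ d → suc m * layer (suc d) (suc m)) (ℕ.+-suc m m) ⟩
  suc m * layer (suc (suc (m + m))) (suc m)     ≡⟨ cong (suc m *_) (layer-suc (suc (m + m)) m) ⟩
  suc m * (b + layer (suc (m + m)) m)           ≡⟨ cong (λ x → suc m * (b + x)) (sym middle) ⟩
  suc m * (b + b)                               ≡⟨ cong (λ x → suc m * (x + x)) (layer-suc (m + m) m) ⟩
  suc m * ((x + c) + (x + c))                   ≡⟨ expand m x c ⟩
  2 * ((suc m * x + m * c) + c)                 ≡⟨ cong (λ y → 2 * (y + c)) (layer-absorption (m + m) m) ⟩
  2 * ((m + m) * c + c)                         ≡⟨ cong (2 *_) (ℕ.+-comm ((m + m) * c) c) ⟩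
  2 * (suc (m + m) * c)                         ∎
  where
  open ≡-Reasoning
  c = central m
  x = layer (m + m) (suc m)
  b = layer (suc (m + m)) (suc m)
  middle : layer (suc (m + m)) (suc m) ≡ layer (suc (m + m)) m
  middle = ℕ.≤-antisym (layer-descending _ m ℕ.≤-refl) (layer-ascending _ m ℕ.≤-refl)
  expand : ∀ m x c → (1 + m) * ((x + c) + (x + c)) ≡ 2 * (((1 + m) * x + m * c) + c)
  expand = solve-∀

-- From m to m+1 the left side grows by 4(2m+1)(2m+3)/(m+1)², and (2m+1)(2m+3) = 4(m+1)² - 1, so
-- this is below the factor 16 on the right. With 2m instead of 2m+1 the factor would exceed 16 and
-- the induction would fail.
central-bound : ∀ m → central m * central m * suc (m + m) ≤ 2 ^ (m + m) * 2 ^ (m + m)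
central-bound zero = ℕ.≤-reflexive (cong (λ x → x * x * 1) (layer-zero 0))
central-bound (suc m) = ℕ.*-cancelˡ-≤ (suc m * suc m) (begin
  suc m * suc m * (c′ * c′ * suc (suc m + suc m))
    ≡⟨ regroup m c′ ⟩
  (suc m * c′) * (suc m * c′) * (3 + (m + m))
    ≡⟨ cong (λ x → x * x * (3 + (m + m))) (central-suc m) ⟩
  (2 * (suc (m + m) * c)) * (2 * (suc (m + m) * c)) * (3 + (m + m))
    ≡⟨ split m c ⟩
  (4 * ((1 + (m + m)) * (3 + (m + m)))) * (c * c * suc (m + m))
    ≤⟨ ℕ.*-mono-≤ (ℕ.*-monoʳ-≤ 4 ratio) (central-bound m) ⟩
  (4 * (4 * (suc m * suc m))) * (p * p)
    ≡⟨ collect (suc m) p ⟩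
  suc m * suc m * ((4 * p) * (4 * p))
    ≡⟨ cong (λ x → suc m * suc m * (x * x)) power ⟩
  suc m * suc m * (2 ^ (suc m + suc m) * 2 ^ (suc m + suc m)) ∎)
  where
  open ℕ.≤-Reasoning
  c = central m
  c′ = central (suc m)
  p = 2 ^ (m + m)
  regroup : ∀ m c → (1 + m) * (1 + m) * (c * c * (1 + ((1 + m) + (1 + m)))) ≡ ((1 + m) * c) * ((1 + m) * c) * (3 + (m + m))
  regroup = solve-∀
  split : ∀ m c → (2 * ((1 + (m + m)) * c)) * (2 * ((1 + (m + m)) * c)) * (3 + (m + m))
                ≡ (4 * ((1 + (m + m)) * (3 + (m + m)))) * (c * c * (1 + (m + m)))
  split = solve-∀
  collect : ∀ n p → (4 * (4 * (n * n))) * (p * p) ≡ n * n * ((4 * p) * (4 * p))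
  collect = solve-∀
  complete-square : ∀ m → 4 * ((1 + m) * (1 + m)) ≡ (1 + (m + m)) * (3 + (m + m)) + 1
  complete-square = solve-∀
  ratio : (1 + (m + m)) * (3 + (m + m)) ≤ 4 * (suc m * suc m)
  ratio = subst ((1 + (m + m)) * (3 + (m + m)) ≤_) (sym (complete-square m)) (ℕ.m≤m+n ((1 + (m + m)) * (3 + (m + m))) 1)
  power : 4 * p ≡ 2 ^ (suc m + suc m)
  power = trans (ℕ.*-assoc 2 2 p) (cong (λ k → 2 ^ suc k) (sym (ℕ.+-suc m m)))

central≥1 : ∀ m → 1 ≤ central m
central≥1 m = subst (_≤ central m) (layer-zero (m + m)) (layer≤central m 0)

halve : ∀ d → ∃[ m ] (d ≡ m + m ⊎ d ≡ suc (m + m))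
halve zero = 0 , inj₁ refl
halve (suc d) with halve d
... | m , inj₁ refl = m , inj₂ refl
... | m , inj₂ refl = suc m , inj₁ (cong suc (sym (ℕ.+-suc m m)))

-- In odd dimension a layer is at most two layers of the even dimension below, and the resulting
-- factor 4 is matched by the right side. The part `1 ≤ L` later absorbs the 1 of n - 1.
layer-bound : ∀ d → ∃[ L ] 1 ≤ L × (∀ w → layer d w ≤ L) × L * L * d ≤ 2 ^ d * 2 ^ d
layer-bound d with halve d
... | m , inj₁ refl = central m , central≥1 m , layer≤central m ,
  ℕ.≤-trans (ℕ.*-monoʳ-≤ (central m * central m) (ℕ.n≤1+n (m + m))) (central-bound m)
... | m , inj₂ refl = c + c , ℕ.≤-trans (central≥1 m) (ℕ.m≤m+n c c) , bound ,
  subst₂ _≤_ (left c (m + m)) (right (2 ^ (m + m))) (ℕ.*-monoʳ-≤ 4 (central-bound m))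
  where
  c = central m
  bound : ∀ w → layer (suc (m + m)) w ≤ c + c
  bound zero    = subst (_≤ c + c) (sym (layer-zero (suc (m + m)))) (ℕ.≤-trans (central≥1 m) (ℕ.m≤m+n c c))
  bound (suc w) = subst (_≤ c + c) (sym (layer-suc (m + m) w)) (ℕ.+-mono-≤ (layer≤central m (suc w)) (layer≤central m w))
  left : ∀ c k → 4 * (c * c * (1 + k)) ≡ (c + c) * (c + c) * (1 + k)
  left = solve-∀
  right : ∀ p → 4 * (p * p) ≡ (2 * p) * (2 * p)
  right = solve-∀

-- The layered colouring

χ-<-suc : ∀ x w → χ (x <? suc w) ≡ χ (x <? w) + χ (x ℕ.≟ w)
χ-<-suc x w with ℕ.<-cmp x w
... | tri< x<w x≢w _ = trans (χ-yes (x <? suc w) (ℕ.m≤n⇒m≤1+n x<w))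
                             (sym (cong₂ _+_ (χ-yes (x <? w) x<w) (χ-no (x ℕ.≟ w) x≢w)))
... | tri≈ x≮w refl _ = trans (χ-yes (x <? suc x) ℕ.≤-refl)
                              (sym (cong₂ _+_ (χ-no (x <? x) x≮w) (χ-yes (x ℕ.≟ x) refl)))
... | tri> x≮w x≢w w<x = trans (χ-no (x <? suc w) (ℕ.<⇒≱ (s≤s w<x)))
                               (sym (cong₂ _+_ (χ-no (x <? w) x≮w) (χ-no (x ℕ.≟ w) x≢w)))

module _ {I : ℕ → Set} (I? : ∀ w → Dec (I w)) where
  χ-<-suc-yes : ∀ x w → I w → χ ((x <? suc w) ×-dec I? x) ≡ χ ((x <? w) ×-dec I? x) + χ (x ℕ.≟ w)
  χ-<-suc-yes x w Iw with x ℕ.≟ w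
  ... | yes refl = trans (χ-yes ((x <? suc x) ×-dec I? x) (ℕ.≤-refl , Iw))
                         (sym (cong₂ _+_ (χ-no ((x <? x) ×-dec I? x) (ℕ.n≮n x ∘ proj₁)) (χ-yes (yes refl) refl)))
  ... | no x≢w   = trans (χ-cong ((x <? suc w) ×-dec I? x) ((x <? w) ×-dec I? x)
                           (λ (x≤w , Ix) → ℕ.≤∧≢⇒< (s≤s⁻¹ x≤w) x≢w , Ix) (λ (x<w , Ix) → ℕ.m≤n⇒m≤1+n x<w , Ix))
                         (sym (trans (cong (λ y → χ ((x <? w) ×-dec I? x) + y) (χ-no (no x≢w) x≢w)) (ℕ.+-identityʳ _)))

  χ-<-suc-no : ∀ x w → ¬ I w → χ ((x <? suc w) ×-dec I? x) ≡ χ ((x <? w) ×-dec I? x)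
  χ-<-suc-no x w ¬Iw = χ-cong ((x <? suc w) ×-dec I? x) ((x <? w) ×-dec I? x)
    (λ (x≤w , Ix) → ℕ.≤∧≢⇒< (s≤s⁻¹ x≤w) (λ { refl → ¬Iw Ix }) , Ix) (λ (x<w , Ix) → ℕ.m≤n⇒m≤1+n x<w , Ix)

below : ℕ → ℕ → ℕ
below d w = size d (λ v → weight v <? w)

below-suc : ∀ d w → below d (suc w) ≡ below d w + layer d w
below-suc d w = trans (∑Q-cong d λ v → χ-<-suc (weight v) w)
  (∑-distrib-+ (λ i → χ (weight (Graph.nth (Q d) i) <? w)) (λ i → χ (weight (Graph.nth (Q d) i) ℕ.≟ w)))

below-≤suc : ∀ d w → below d w ≤ below d (suc w)
below-≤suc d w = subst (below d w ≤_) (sym (below-suc d w)) (ℕ.m≤m+n _ _)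

below-pred : ∀ d w → below d (pred w) ≤ below d w
below-pred d zero    = ℕ.≤-refl
below-pred d (suc w) = below-≤suc d w

layer-inhabited : ∀ {d} (v : Vec Bool d) → 1 ≤ layer d (weight v)
layer-inhabited {d} v = ℕ.≤-trans
  (ℕ.≤-reflexive (sym (χ-yes (weight (nth (index v)) ℕ.≟ weight v) (cong weight (nth-index v)))))
  (≤-sum (λ i → χ (weight (nth i) ℕ.≟ weight v)) (index v))
  where open Graph (Q d)

-- The layer of `v` is not counted and is nonempty. Strictness is what keeps `level` below `r`, and
-- the reason why `low-end` has to exhibit a vertex.
below<2^d : ∀ {d} (v : Vec Bool d) → below d (weight v) < 2 ^ d
below<2^d {d} v = begin
  suc (below d w)             ≡⟨ ℕ.+-comm 1 (below d w) ⟩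
  below d w + 1               ≤⟨ ℕ.+-monoʳ-≤ (below d w) (layer-inhabited v) ⟩
  below d w + layer d w       ≡⟨ below-suc d w ⟨
  below d (suc w)             ≤⟨ size≤2^ d (λ v → weight v <? suc w) ⟩
  2 ^ d                       ∎
  where
  open ℕ.≤-Reasoning
  w = weight v

-- A block of consecutive layers, enlarged by one layer on either side, whose
-- cumulative sizes (scaled by r) stay between a and b.
module Block (d r a b L : ℕ) (layer≤L : ∀ w → layer d w ≤ L) where
  I : ℕ → Set
  I w = a ≤ r * below d w × r * below d (pred w) < b

  I? : ∀ w → Dec (I w)
  I? w = (a ≤? r * below d w) ×-dec (r * below d (pred w) <? b)

  initial : ℕ → ℕ
  initial W = size d (λ v → (weight v <? W) ×-dec I? (weight v))

  below-step : ∀ w → below d w ≤ below d (pred w) + L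
  below-step zero    = ℕ.m≤m+n _ _
  below-step (suc w) = subst (_≤ below d w + L) (sym (below-suc d w)) (ℕ.+-monoʳ-≤ (below d w) (layer≤L w))

  -- The first part says that at least a/r vertices precede those counted in the block. At a layer
  -- of the block it yields the second: `r * below d (pred W)` is less than `b`, and only two more
  -- layers are added. Outside the block the count is unchanged. The empty case is separate because
  -- `a` exceeds `r * below d W` before the block begins.
  initial-bound : ∀ W → (initial W ≡ 0 ⊎ a + r * initial W ≤ r * below d W)
                      × (initial W ≡ 0 ⊎ a + r * initial W ≤ b + r * (L + L))
  initial-bound zero = inj₁ none , inj₁ none
    where
    none : initial 0 ≡ 0
    none = sum-zero {2 ^ d} λ i → χ-no ((weight (Graph.nth (Q d) i) <? 0) ×-dec I? _) λ ()
  initial-bound (suc W) with I? W | initial-bound W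
  ... | no ¬I | below-W , bounded =
      Sum.map (trans same) (λ le → subst (λ x → a + r * x ≤ _) (sym same) (ℕ.≤-trans le (ℕ.*-monoʳ-≤ r (below-≤suc d W)))) below-W
    , Sum.map (trans same) (subst (λ x → a + r * x ≤ b + r * (L + L)) (sym same)) bounded
    where
    same : initial (suc W) ≡ initial W
    same = ∑Q-cong d λ v → χ-<-suc-no I? (weight v) W ¬I
  ... | yes (a≤ , <b) | below-W , _ = inj₂ new , inj₂ (ℕ.≤-trans new (begin
      r * below d (suc W)                               ≡⟨ cong (r *_) (below-suc d W) ⟩
      r * (below d W + layer d W)                       ≤⟨ ℕ.*-monoʳ-≤ r (ℕ.+-mono-≤ (below-step W) (layer≤L W)) ⟩
      r * (below d (pred W) + L + L)                  ≡⟨ cong (r *_) (ℕ.+-assoc (below d (pred W)) L L) ⟩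
      r * (below d (pred W) + (L + L))                ≡⟨ ℕ.*-distribˡ-+ r (below d (pred W)) (L + L) ⟩
      r * below d (pred W) + r * (L + L)              ≤⟨ ℕ.+-monoˡ-≤ (r * (L + L)) (ℕ.<⇒≤ <b) ⟩
      b + r * (L + L)                                   ∎))
    where
    open ℕ.≤-Reasoning
    grown : initial (suc W) ≡ initial W + layer d W
    grown = trans (∑Q-cong d λ v → χ-<-suc-yes I? (weight v) W (a≤ , <b))
      (∑-distrib-+ (λ i → χ ((weight (Graph.nth (Q d) i) <? W) ×-dec I? (weight (Graph.nth (Q d) i))))
                   (λ i → χ (weight (Graph.nth (Q d) i) ℕ.≟ W)))
    old : a + r * initial W ≤ r * below d W
    old = case below-W of λ
      { (inj₁ none) → subst (λ x → a + r * x ≤ r * below d W) (sym none)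
                        (subst (_≤ r * below d W) (sym (trans (cong (a +_) (ℕ.*-zeroʳ r)) (ℕ.+-identityʳ a))) a≤)
      ; (inj₂ le) → le }
    new : a + r * initial (suc W) ≤ r * below d (suc W)
    new = begin
      a + r * initial (suc W)                 ≡⟨ cong (λ x → a + r * x) grown ⟩
      a + r * (initial W + layer d W)         ≡⟨ cong (a +_) (ℕ.*-distribˡ-+ r (initial W) (layer d W)) ⟩
      a + (r * initial W + r * layer d W)     ≡⟨ ℕ.+-assoc a _ _ ⟨
      a + r * initial W + r * layer d W       ≤⟨ ℕ.+-monoˡ-≤ (r * layer d W) old ⟩
      r * below d W + r * layer d W           ≡⟨ ℕ.*-distribˡ-+ r (below d W) (layer d W) ⟨
      r * (below d W + layer d W)             ≡⟨ cong (r *_) (below-suc d W) ⟨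
      r * below d (suc W)                     ∎

  block-bound : a ≤ b → a + r * size d (λ v → I? (weight v)) ≤ b + r * (L + L)
  block-bound a≤b = subst (λ x → a + r * x ≤ b + r * (L + L)) all (case proj₂ (initial-bound (suc d)) of λ
    { (inj₁ none) → subst (λ x → a + r * x ≤ b + r * (L + L)) (sym none)
        (ℕ.+-mono-≤ a≤b (ℕ.*-monoʳ-≤ r z≤n))
    ; (inj₂ le) → le })
    where
    all : initial (suc d) ≡ size d (λ v → I? (weight v))
    all = ∑Q-cong d λ v → χ-cong ((weight v <? suc d) ×-dec I? (weight v)) (I? (weight v)) proj₂ (λ i → s≤s (weight≤d v) , i)

module Cube (d r : ℕ) .{{_ : NonZero r}} where
  open Discrepancy r (Q d) Q-connected public

  N : ℕ
  N = 2 ^ d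

  instance
    N-nonZero : NonZero N
    N-nonZero = ℕ.m^n≢0 2 d

module LayeredColouring (d r : ℕ) .{{_ : NonZero r}} where
  open Cube d r

  low : E → ℕ
  low e = weight (head e) ⊓ weight (tail e)

  -- The colours are r blocks of consecutive layers of about N / r vertices each; an
  -- edge takes the block of its lower end.
  level : E → ℕ
  level e = (r * below d (low e)) / N

  Near : ℕ → ℕ → Set
  Near w x = x ≡ w ⊎ x ≡ suc w

  ends-near : ∀ e → Near (low e) (weight (head e)) × Near (low e) (weight (tail e))
  ends-near e with adj-flip {u = head e} {v = tail e} (edge-adj e)
  ... | j , eq with weight-flip j (head e)
  ...   | inj₁ up   = near₁ (trans (cong weight eq) up)
    where
    near₁ : ∀ {x y} → y ≡ suc x → Near (x ⊓ y) x × Near (x ⊓ y) y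
    near₁ {x} refl rewrite ℕ.m≤n⇒m⊓n≡m (ℕ.n≤1+n x) = inj₁ refl , inj₂ refl
  ...   | inj₂ down = near₂ (trans down (cong (suc ∘ weight) (sym eq)))
    where
    near₂ : ∀ {x y} → x ≡ suc y → Near (x ⊓ y) x × Near (x ⊓ y) y
    near₂ {y = y} refl rewrite ℕ.m≥n⇒m⊓n≡n (ℕ.n≤1+n y) = inj₂ refl , inj₁ refl

  low-end : ∀ e → ∃[ v ] weight v ≡ low e
  low-end e with ends-near e
  ... | inj₁ eq , _      = head e , eq
  ... | inj₂ _  , inj₁ eq = tail e , eq
  ... | inj₂ p , inj₂ q  = contradiction (cong₂ _⊓_ p q)
    (λ eq → ℕ.1+n≢n (sym (trans eq (ℕ.⊓-idem (suc (low e))))))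

  level<r : ∀ e → level e < r
  level<r e = m<n*o⇒m/o<n (ℕ.*-monoʳ-< r (subst (λ w → below d w < N) (proj₂ (low-end e)) (below<2^d (proj₁ (low-end e)))))

  colouring : Colouring r (Q d)
  colouring e = fromℕ< (level<r e)

  module _ (L : ℕ) (layer≤L : ∀ w → layer d w ≤ L) where
    module _ (i : Fin r) where
      open Block d r (toℕ i * N) (suc (toℕ i) * N) L layer≤L

      lower-≤ : ∀ w → (r * below d w) / N ≡ toℕ i → toℕ i * N ≤ r * below d w
      lower-≤ w eq = subst (λ q → q * N ≤ r * below d w) eq (m/n*n≤m (r * below d w) N)

      upper-< : ∀ w → (r * below d w) / N ≡ toℕ i → r * below d w < suc (toℕ i) * N
      upper-< w eq = subst (_< suc (toℕ i) * N) (sym (m≡m%n+[m/n]*n (r * below d w) N))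
        (subst (λ q → (r * below d w) % N + q * N < suc (toℕ i) * N) (sym eq) (ℕ.+-monoˡ-< (toℕ i * N) (m%n<n (r * below d w) N)))

      near-I : ∀ w x → (r * below d w) / N ≡ toℕ i → Near w x → I x
      near-I w x eq (inj₁ refl) = lower-≤ w eq , ℕ.≤-<-trans (ℕ.*-monoʳ-≤ r (below-pred d w)) (upper-< w eq)
      near-I w x eq (inj₂ refl) = ℕ.≤-trans (lower-≤ w eq) (ℕ.*-monoʳ-≤ r (below-≤suc d w)) , upper-< w eq

      -- Both ends of an edge of colour `i` lie in the enlarged block by `near-I`, and the limits of
      -- that block differ by `N`.
      class-bound : r * colour-rank colouring i ≤ N + r * (L + L)
      class-bound = ℕ.≤-trans (ℕ.*-monoʳ-≤ r (rank-cover (λ v → I? (weight v)) λ e e∈ →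
          let eq = trans (sym (Fin.toℕ-fromℕ< (level<r e))) (cong toℕ (class-∈ colouring e∈))
              (p , q) = ends-near e
          in near-I (low e) _ eq p , near-I (low e) _ eq q))
        (ℕ.+-cancelˡ-≤ (toℕ i * N) _ _ (ℕ.≤-trans (block-bound (ℕ.m≤n+m (toℕ i * N) N))
          (ℕ.≤-reflexive (rearrange (toℕ i * N) N (r * (L + L))))))
        where
        rearrange : ∀ a n x → n + a + x ≡ a + (n + x)
        rearrange = solve-∀

    optimal-bound : r * φ optimal ≤ N + r * (L + L)
    optimal-bound = ℕ.≤-trans (ℕ.*-monoʳ-≤ r (optimal≤ colouring)) (class-bound (top colouring))

-- The lower bound for an arbitrary colouring

flip-injective : ∀ {d} (i j : Fin d) v → flip i v ≡ flip j v → i ≡ j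
flip-injective zero    zero    _       _  = refl
flip-injective zero    (suc j) (b ∷ v) eq = contradiction (sym (cong Vec.head eq)) (not-¬ refl)
flip-injective (suc i) zero    (b ∷ v) eq = contradiction (cong Vec.head eq) (not-¬ refl)
flip-injective (suc i) (suc j) (b ∷ v) eq = cong suc (flip-injective i j v (cong Vec.tail eq))

module Components {n : ℕ} (G : SimpleGraph n) (l : SimpleGraph.V G → SimpleGraph.V G)
                  (l-idem : ∀ x → l (l x) ≡ l x) where
  open Graph G

  component : V → ℕ
  component x = ∑V (λ v → χ (l v ≟V x))

  component-≥ : ∀ {m} {J : Fin m → Set} (J? : ∀ j → Dec (J j)) (h : Fin m → V) {x} →
                (∀ {i j} → h i ≡ h j → i ≡ j) → (∀ {j} → J j → l (h j) ≡ x) → sum (χ ∘ J?) ≤ component x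
  component-≥ J? h {x} h-inj h-lab = count-injection J? (λ i → l (nth i) ≟V x) (index ∘ h)
    (λ _ _ eq → h-inj (index-injective eq)) (λ {j} p → trans (cong l (nth-index (h j))) (h-lab p))

  component-≥1 : ∀ v → 1 ≤ component (l v)
  component-≥1 v = ℕ.≤-trans
    (ℕ.≤-reflexive (sym (χ-yes (l (nth (index v)) ≟V l v) (cong l (nth-index v)))))
    (≤-sum (λ i → χ (l (nth i) ≟V l v)) (index v))

  component-≥2 : ∀ {u v} → u ≢ v → l u ≡ l v → 2 ≤ component (l v)
  component-≥2 {u} {v} u≢v eq = subst (_≤ component (l v)) two
    (component-≥ {2} (λ _ → yes refl) h {l v} (λ {i} {j} → h-inj i j) (λ {j} → λ (_ : 0 ≡ 0) → h-lab j))
    where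
    two : sum {2} (λ _ → χ (yes (refl {x = 0}))) ≡ 2
    two = cong (λ x → x + (x + 0)) (χ-yes (yes (refl {x = 0})) refl)
    h : Fin 2 → V
    h zero    = u
    h (suc _) = v
    h-inj : ∀ i j → h i ≡ h j → i ≡ j
    h-inj zero       zero       _  = refl
    h-inj zero       (suc zero) eq = contradiction eq u≢v
    h-inj (suc zero) zero       eq = contradiction (sym eq) u≢v
    h-inj (suc zero) (suc zero) _  = refl
    h-lab : ∀ j → l (h j) ≡ l v
    h-lab zero    = eq
    h-lab (suc _) = refl

  -- Summing K ≤ c * w v over the c vertices of a component and cancelling c shows that
  -- every component carries weight at least K.
  component-weights : ∀ K (w : V → ℕ) → (∀ v → K ≤ component (l v) * w v) → K * fix l ≤ ∑V w
  component-weights K w heavy = begin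
    K * fix l                                                      ≡⟨ sum-*ˡ K (λ i → χ (l (nth i) ≟V nth i)) ⟩
    sum (λ i → K * χ (l (nth i) ≟V nth i))                         ≤⟨ sum-mono (λ i → root (nth i)) ⟩
    sum (λ i → sum (λ j → χ (l (nth j) ≟V nth i) * w (nth j)))     ≡⟨ ∑-comm (λ i j → χ (l (nth j) ≟V nth i) * w (nth j)) ⟩
    sum (λ j → sum (λ i → χ (l (nth j) ≟V nth i) * w (nth j)))     ≡⟨ sum-cong-≗ (λ j → column (nth j)) ⟩
    ∑V w                                                           ∎
    where
    open ℕ.≤-Reasoning
    column : ∀ v → ∑V (λ x → χ (l v ≟V x) * w v) ≡ w v
    column v = trans (∑V-single (λ x → χ (l v ≟V x) * w v) (l v) λ x x≢ → cong (_* w v) (χ-no (l v ≟V x) (≢-sym x≢)))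
      (trans (cong (_* w v) (χ-yes (l v ≟V l v) refl)) (ℕ.*-identityˡ (w v)))
    pointwise : ∀ x v → χ (l v ≟V x) * K ≤ component x * (χ (l v ≟V x) * w v)
    pointwise x v with l v ≟V x
    ... | yes refl = begin
      χ (yes refl) * K                              ≡⟨ trans (cong (_* K) (χ-yes (yes refl) refl)) (ℕ.*-identityˡ K) ⟩
      K                                             ≤⟨ heavy v ⟩
      component (l v) * w v                         ≡⟨ cong (component (l v) *_) (trans (cong (_* w v) (χ-yes (yes refl) refl)) (ℕ.*-identityˡ (w v))) ⟨
      component (l v) * (χ (yes refl) * w v)        ∎
    ... | no ≢ = subst (λ y → y * K ≤ component x * (y * w v)) (sym (χ-no (no ≢) ≢)) z≤n
    root : ∀ x → K * χ (l x ≟V x) ≤ ∑V (λ v → χ (l v ≟V x) * w v)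
    root x with l x ≟V x
    ... | no ≢ = subst (_≤ ∑V (λ v → χ (l v ≟V x) * w v))
      (sym (trans (cong (K *_) (χ-no (no ≢) ≢)) (ℕ.*-zeroʳ K))) z≤n
    ... | yes lx≡x = subst (_≤ ∑V (λ v → χ (l v ≟V x) * w v))
      (sym (trans (cong (K *_) (χ-yes (yes lx≡x) lx≡x)) (ℕ.*-identityʳ K)))
      (ℕ.*-cancelˡ-≤ (component x) {{>-nonZero (subst (λ y → 1 ≤ component y) lx≡x (component-≥1 x))}} (begin
        component x * K                                           ≡⟨ sum-*ʳ K (λ i → χ (l (nth i) ≟V x)) ⟩
        sum (λ i → χ (l (nth i) ≟V x) * K)                        ≤⟨ sum-mono (λ i → pointwise x (nth i)) ⟩
        sum (λ i → component x * (χ (l (nth i) ≟V x) * w (nth i))) ≡⟨ sum-*ˡ (component x) (λ i → χ (l (nth i) ≟V x) * w (nth i)) ⟨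
        component x * ∑V (λ v → χ (l v ≟V x) * w v)               ∎))

sum-χ-≟ : ∀ {r} (j : Fin r) → sum (λ i → χ (i Fin.≟ j)) ≡ 1
sum-χ-≟ j = trans (sum-single j λ i i≢j → χ-no (i Fin.≟ j) i≢j) (χ-yes (j Fin.≟ j) refl)

module Activity (d r q : ℕ) .{{_ : NonZero r}} (rq≤d : r * q ≤ d) (f : Colouring r (Q d)) where
  open Cube d r hiding (N)

  edgeAt : Vec Bool d → Fin d → E
  edgeAt v j = proj₁ (edge {v} {flip j v} (flip-adj j v))

  edgeAt-joins : ∀ v j → Joins (edgeAt v j) v (flip j v)
  edgeAt-joins v j = proj₂ (edge {v} {flip j v} (flip-adj j v))

  colourAt : Vec Bool d → Fin d → Fin r
  colourAt v j = f (edgeAt v j)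

  colourAt-flip : ∀ v j → colourAt (flip j v) j ≡ colourAt v j
  colourAt-flip v j = cong f (edge-unique {u = flip j v} {v = v}
    (subst (Joins (edgeAt (flip j v) j) (flip j v)) (flip-involutive j v) (edgeAt-joins (flip j v) j))
    (Sum.swap (edgeAt-joins v j)))

  label : Fin r → Vec Bool d → Vec Bool d
  label i = Spanning.label (colourClass r (Q d) f i)

  label-flip : ∀ i v j → colourAt v j ≡ i → label i (flip j v) ≡ label i v
  label-flip i v j eq = sym (Compatible-Joined {l = label i} (Spanning.label-compatible (colourClass r (Q d) f i))
    (edgeAt v j , ∈-class f eq , edgeAt-joins v j))

  degree : Vec Bool d → Fin r → ℕ
  degree v i = sum (λ j → χ (i Fin.≟ colourAt v j))

  ∑degree : ∀ v → sum (degree v) ≡ d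
  ∑degree v = trans (∑-comm (λ i j → χ (i Fin.≟ colourAt v j)))
    (trans (sum-cong-≗ λ j → sum-χ-≟ (colourAt v j)) (trans (sum-const d 1) (ℕ.*-identityʳ d)))

  dom : Vec Bool d → Fin r
  dom v = proj₁ (argmax (degree v))

  q≤degree-dom : ∀ v → q ≤ degree v (dom v)
  q≤degree-dom v = ℕ.*-cancelˡ-≤ r (begin
    r * q                       ≤⟨ rq≤d ⟩
    d                           ≡⟨ ∑degree v ⟨
    sum (degree v)              ≤⟨ sum-mono (proj₂ (argmax (degree v))) ⟩
    sum {r} (λ _ → degree v (dom v)) ≡⟨ sum-const r _ ⟩
    r * degree v (dom v)        ∎)
    where open ℕ.≤-Reasoning

  Mixed : Vec Bool d → Set
  Mixed v = ∃[ j ] colourAt v j ≢ dom v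

  Mixed? : ∀ v → Dec (Mixed v)
  Mixed? v = Fin.any? λ j → ¬? (colourAt v j Fin.≟ dom v)

  Pure : Fin r → Vec Bool d → Set
  Pure i v = dom v ≡ i × ¬ Mixed v

  Pure? : ∀ i v → Dec (Pure i v)
  Pure? i v = (dom v Fin.≟ i) ×-dec ¬? (Mixed? v)

  ¬Mixed⇒colourAt : ∀ v j → ¬ Mixed v → colourAt v j ≡ dom v
  ¬Mixed⇒colourAt v j ¬m = decidable-stable (colourAt v j Fin.≟ dom v) λ ≢ → ¬m (j , ≢)

  -- The edge in direction `j` has colour `i` since `v` is pure, and a neighbour that is not mixed
  -- has its dominant colour on every edge, this one included.
  Pure-closed : ∀ i j v → Pure i v → Pure i (flip j v) ⊎ Mixed (flip j v)
  Pure-closed i j v (refl , pure) with Mixed? (flip j v)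
  ... | yes m = inj₂ m
  ... | no ¬m = inj₁ (trans (sym (¬Mixed⇒colourAt (flip j v) j ¬m)) (trans (colourAt-flip v j) (¬Mixed⇒colourAt v j pure)) , ¬m)

  -- In colour i, the component of v has at least 1 + degree v i vertices; hence
  -- 2q / |component| is at most q if i occurs at v, and at most 2 if degree v i ≥ q.
  wt : Fin r → Vec Bool d → ℕ
  wt i v with i Fin.≟ dom v | Fin.any? (λ j → colourAt v j Fin.≟ i)
  ... | yes _ | _     = 2
  ... | no _  | yes _ = q
  ... | no _  | no _  = q + q

  module _ (i : Fin r) where
    private
      forest = Spanning.forestF (colourClass r (Q d) f i)
    open Components (Q d) (label i) (Forest.lab-idem forest)

    heavy : ∀ v → q + q ≤ component (label i v) * wt i v
    heavy v with i Fin.≟ dom v | Fin.any? (λ j → colourAt v j Fin.≟ i)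
    -- The neighbours along edges of the dominant colour, even without `v`, give `q` vertices of the
    -- component.
    ... | yes refl | _ = ℕ.≤-trans
      (ℕ.≤-reflexive (trans (cong (q +_) (sym (ℕ.+-identityʳ q))) (ℕ.*-comm 2 q)))
      (ℕ.*-monoˡ-≤ 2 (ℕ.≤-trans (q≤degree-dom v) (component-≥ (λ j → dom v Fin.≟ colourAt v j) (λ j → flip j v)
        (λ {j} {k} → flip-injective j k v) (λ {j} eq → label-flip (dom v) v j (sym eq)))))
    ... | no _ | yes (j , eq) = ℕ.≤-trans (ℕ.≤-reflexive (cong (q +_) (sym (ℕ.+-identityʳ q))))
      (ℕ.*-monoˡ-≤ q (component-≥2 (≢-sym (Adj⇒≢ (flip-adj j v))) (label-flip i v j eq)))
    ... | no _ | no _ = ℕ.≤-trans (ℕ.≤-reflexive (sym (ℕ.*-identityˡ (q + q))))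
      (ℕ.*-monoˡ-≤ (q + q) (component-≥1 v))

    weighted-rank : (q + q) * 2 ^ d ≤ ∑V (wt i) + (q + q) * φ f
    weighted-rank = begin
      (q + q) * 2 ^ d                                       ≡⟨ cong ((q + q) *_) (Forest.card forest) ⟨
      (q + q) * (colour-rank f i + fix (label i))           ≡⟨ ℕ.*-distribˡ-+ (q + q) (colour-rank f i) _ ⟩
      (q + q) * colour-rank f i + (q + q) * fix (label i)   ≤⟨ ℕ.+-mono-≤ (ℕ.*-monoʳ-≤ (q + q) (colour-rank≤φ f i)) (component-weights (q + q) (wt i) heavy) ⟩
      (q + q) * φ f + ∑V (wt i)                             ≡⟨ ℕ.+-comm ((q + q) * φ f) _ ⟩
      ∑V (wt i) + (q + q) * φ f                             ∎
      where open ℕ.≤-Reasoning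

sum-+-single : ∀ {r} (g : Fin r → ℕ) K j → sum (λ i → g i + K * χ (i Fin.≟ j)) ≡ sum g + K
sum-+-single g K j = trans (∑-distrib-+ g (λ i → K * χ (i Fin.≟ j))) (cong (sum g +_) (begin
  sum (λ i → K * χ (i Fin.≟ j))   ≡⟨ sum-*ˡ K (λ i → χ (i Fin.≟ j)) ⟨
  K * sum (λ i → χ (i Fin.≟ j))   ≡⟨ cong (K *_) (sum-χ-≟ j) ⟩
  K * 1                           ≡⟨ ℕ.*-identityʳ K ⟩
  K                               ∎))
  where open ≡-Reasoning

*χ-yes : ∀ {P : Set} K (P? : Dec P) → P → K * χ P? ≡ K
*χ-yes K P? p = trans (cong (K *_) (χ-yes P? p)) (ℕ.*-identityʳ K)

*χ-no : ∀ {P : Set} K (P? : Dec P) → ¬ P → K * χ P? ≡ 0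
*χ-no K P? ¬p = trans (cong (K *_) (χ-no P? ¬p)) (ℕ.*-zeroʳ K)

module Counting (d r q : ℕ) .{{_ : NonZero r}} (rq≤d : r * q ≤ d) (f : Colouring r (Q d)) where
  open Cube d r
  open Activity d r q rq≤d f

  wt-dom : ∀ v → wt (dom v) v ≡ 2
  wt-dom v with dom v Fin.≟ dom v | Fin.any? (λ j → colourAt v j Fin.≟ dom v)
  ... | yes _ | _ = refl
  ... | no ≢  | _ = contradiction refl ≢

  wt-active : ∀ i v j → i ≢ dom v → colourAt v j ≡ i → wt i v ≡ q
  wt-active i v j i≢ eq with i Fin.≟ dom v | Fin.any? (λ j → colourAt v j Fin.≟ i)
  ... | yes i≡ | _      = contradiction i≡ i≢
  ... | no _   | yes _  = refl
  ... | no _   | no ¬a  = contradiction (j , eq) ¬a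

  wt-≤ : ∀ i v → i ≢ dom v → wt i v ≤ q + q
  wt-≤ i v i≢ with i Fin.≟ dom v | Fin.any? (λ j → colourAt v j Fin.≟ i)
  ... | yes i≡ | _      = contradiction i≡ i≢
  ... | no _   | yes _  = ℕ.m≤m+n q q
  ... | no _   | no ¬a  = ℕ.≤-refl

  pure-pointwise : ∀ v i → wt i v + (q + q) * χ (i Fin.≟ dom v) ≤ (q + q) + 2 * χ (i Fin.≟ dom v)
  pure-pointwise v i = case i Fin.≟ dom v of λ
    { (yes refl) → ℕ.≤-reflexive (begin
        wt (dom v) v + (q + q) * χ (dom v Fin.≟ dom v)
          ≡⟨ cong₂ _+_ (wt-dom v) (*χ-yes (q + q) (dom v Fin.≟ dom v) refl) ⟩
        2 + (q + q)
          ≡⟨ ℕ.+-comm 2 (q + q) ⟩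
        (q + q) + 2
          ≡⟨ cong ((q + q) +_) (*χ-yes 2 (dom v Fin.≟ dom v) refl) ⟨
        (q + q) + 2 * χ (dom v Fin.≟ dom v) ∎)
    ; (no i≢) → ℕ.≤-trans (ℕ.≤-reflexive (trans (cong (wt i v +_) (*χ-no (q + q) (i Fin.≟ dom v) i≢)) (ℕ.+-identityʳ _)))
                          (ℕ.≤-trans (wt-≤ i v i≢) (ℕ.m≤m+n (q + q) _)) }
    where open ≡-Reasoning

  mixed-pointwise : ∀ v j → colourAt v j ≢ dom v → ∀ i →
    wt i v + (q + q) * χ (i Fin.≟ dom v) + q * χ (i Fin.≟ colourAt v j) ≤ (q + q) + 2 * χ (i Fin.≟ dom v)
  mixed-pointwise v j ≢dom i = case i Fin.≟ colourAt v j of λ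
    { (no i≢) → ℕ.≤-trans (ℕ.≤-reflexive (trans (cong (wt i v + (q + q) * χ (i Fin.≟ dom v) +_)
                             (*χ-no q (i Fin.≟ colourAt v j) i≢)) (ℕ.+-identityʳ _))) (pure-pointwise v i)
    ; (yes refl) → ℕ.≤-trans (ℕ.≤-reflexive (cong₂ _+_
                       (trans (cong₂ _+_ (wt-active _ v j ≢dom refl) (*χ-no (q + q) (colourAt v j Fin.≟ dom v) ≢dom)) (ℕ.+-identityʳ q))
                       (*χ-yes q (colourAt v j Fin.≟ colourAt v j) refl)))
                     (ℕ.m≤m+n (q + q) _) }

  -- Against `2q` for every colour, the dominant one saves `2q − 2`, and at a mixed vertex the
  -- colour of the witnessing direction saves another `q`. The savings stand on the left to avoid
  -- subtraction.
  total-weight : ∀ v → sum (λ i → wt i v) + (q + q) + q * χ (Mixed? v) ≤ r * (q + q) + 2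
  total-weight v = case Mixed? v of λ
    { (yes m@(j , ≢dom)) → begin
        sum (λ i → wt i v) + (q + q) + q * χ (Mixed? v)
          ≡⟨ cong₂ _+_ (sym (sum-+-single (λ i → wt i v) (q + q) (dom v))) (*χ-yes q (Mixed? v) m) ⟩
        sum (λ i → wt i v + (q + q) * χ (i Fin.≟ dom v)) + q
          ≡⟨ sum-+-single (λ i → wt i v + (q + q) * χ (i Fin.≟ dom v)) q (colourAt v j) ⟨
        sum (λ i → wt i v + (q + q) * χ (i Fin.≟ dom v) + q * χ (i Fin.≟ colourAt v j))
          ≤⟨ sum-mono (mixed-pointwise v j ≢dom) ⟩
        sum (λ i → (q + q) + 2 * χ (i Fin.≟ dom v))
          ≡⟨ right ⟩
        r * (q + q) + 2 ∎
    ; (no ¬m) → begin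
        sum (λ i → wt i v) + (q + q) + q * χ (Mixed? v)
          ≡⟨ trans (cong (λ x → sum (λ i → wt i v) + (q + q) + x) (*χ-no q (Mixed? v) ¬m)) (ℕ.+-identityʳ _) ⟩
        sum (λ i → wt i v) + (q + q)
          ≡⟨ sum-+-single (λ i → wt i v) (q + q) (dom v) ⟨
        sum (λ i → wt i v + (q + q) * χ (i Fin.≟ dom v))
          ≤⟨ sum-mono (pure-pointwise v) ⟩
        sum (λ i → (q + q) + 2 * χ (i Fin.≟ dom v))
          ≡⟨ right ⟩
        r * (q + q) + 2 ∎ }
    where
    open ℕ.≤-Reasoning
    right : sum (λ i → (q + q) + 2 * χ (i Fin.≟ dom v)) ≡ r * (q + q) + 2
    right = trans (sum-+-single (λ _ → q + q) 2 (dom v)) (cong (_+ 2) (sum-const r (q + q)))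

  mixed : ℕ
  mixed = size d Mixed?

  pure : Fin r → ℕ
  pure i = size d (Pure? i)

  ∑Q-const : ∀ c → ∑Q d (λ _ → c) ≡ N * c
  ∑Q-const c = sum-const N c

  -- Sum `weighted-rank` over the colours and exchange the sums, so that `total-weight` applies
  -- vertex by vertex; everything is scaled by `2q`.
  mixed-inequality : q * mixed + (q + q) * N ≤ N * 2 + (q + q) * (r * φ f)
  mixed-inequality = ℕ.+-cancelˡ-≤ (r * ((q + q) * N)) _ _ (begin
    r * ((q + q) * N) + (q * mixed + (q + q) * N)
      ≤⟨ ℕ.+-monoˡ-≤ _ (ℕ.≤-trans (ℕ.≤-reflexive (sym (sum-const r ((q + q) * N)))) (sum-mono weighted-rank)) ⟩
    sum (λ i → ∑V (wt i) + (q + q) * φ f) + (q * mixed + (q + q) * N)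
      ≡⟨ cong (_+ (q * mixed + (q + q) * N)) (trans (∑-distrib-+ (λ i → ∑V (wt i)) (λ _ → (q + q) * φ f))
           (cong₂ _+_ (∑-comm (λ i k → wt i (nth k))) (sum-const r _))) ⟩
    W + r * ((q + q) * φ f) + (q * mixed + (q + q) * N)
      ≡⟨ shuffle W r q (φ f) mixed N ⟩
    (W + N * (q + q)) + q * mixed + (q + q) * (r * φ f)
      ≡⟨ cong (_+ (q + q) * (r * φ f)) left ⟩
    ∑V (λ v → sum (λ i → wt i v) + (q + q) + q * χ (Mixed? v)) + (q + q) * (r * φ f)
      ≤⟨ ℕ.+-monoˡ-≤ _ (∑Q-mono d total-weight) ⟩
    ∑V (λ _ → r * (q + q) + 2) + (q + q) * (r * φ f)
      ≡⟨ cong (_+ (q + q) * (r * φ f)) (∑Q-const (r * (q + q) + 2)) ⟩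
    N * (r * (q + q) + 2) + (q + q) * (r * φ f)
      ≡⟨ collect N r q (φ f) ⟩
    r * ((q + q) * N) + (N * 2 + (q + q) * (r * φ f)) ∎)
    where
    open ℕ.≤-Reasoning
    W = ∑V (λ v → sum (λ i → wt i v))
    shuffle : ∀ W r q m S N → W + r * ((q + q) * m) + (q * S + (q + q) * N) ≡ (W + N * (q + q)) + q * S + (q + q) * (r * m)
    shuffle = solve-∀
    collect : ∀ N r q m → N * (r * (q + q) + 2) + (q + q) * (r * m) ≡ r * ((q + q) * N) + (N * 2 + (q + q) * (r * m))
    collect = solve-∀
    left : (W + N * (q + q)) + q * mixed ≡ ∑V (λ v → sum (λ i → wt i v) + (q + q) + q * χ (Mixed? v))
    left = sym (trans (∑-distrib-+ (λ k → sum (λ i → wt i (nth k)) + (q + q)) (λ k → q * χ (Mixed? (nth k))))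
      (cong₂ _+_ (trans (∑-distrib-+ (λ k → sum (λ i → wt i (nth k))) (λ _ → q + q)) (cong (W +_) (∑Q-const (q + q))))
                 (sym (sum-*ˡ q (λ k → χ (Mixed? (nth k)))))))

  wt-pure : ∀ i v → wt i v + (q + q) * χ (Pure? i v) ≤ (q + q) + 2
  wt-pure i v = case i Fin.≟ dom v of λ
    { (yes refl) → ℕ.≤-trans (ℕ.≤-reflexive (cong (_+ (q + q) * χ (Pure? (dom v) v)) (wt-dom v)))
        (ℕ.≤-trans (ℕ.+-monoʳ-≤ 2 (ℕ.≤-trans (ℕ.*-monoʳ-≤ (q + q) (χ≤1 (Pure? (dom v) v))) (ℕ.≤-reflexive (ℕ.*-identityʳ (q + q)))))
                   (ℕ.≤-reflexive (ℕ.+-comm 2 (q + q))))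
    ; (no i≢) → ℕ.≤-trans (ℕ.≤-reflexive (trans (cong (wt i v +_) (*χ-no (q + q) (Pure? i v) (≢-sym i≢ ∘ proj₁))) (ℕ.+-identityʳ _)))
        (ℕ.≤-trans (wt-≤ i v i≢) (ℕ.m≤m+n (q + q) 2)) }

  -- Only colour `i` is used: its weight drops from `2q` to 2 on `Vᵢ`, and the surplus 2 per vertex
  -- becomes the term `N` after halving.
  pure-inequality : ∀ i → q * pure i ≤ N + q * φ f
  pure-inequality i = ℕ.*-cancelˡ-≤ 2 (ℕ.+-cancelˡ-≤ ((q + q) * N) _ _ (begin
    (q + q) * N + 2 * (q * pure i)
      ≤⟨ ℕ.+-monoˡ-≤ _ (weighted-rank i) ⟩
    ∑V (wt i) + (q + q) * φ f + 2 * (q * pure i)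
      ≡⟨ shuffle (∑V (wt i)) q (φ f) (pure i) ⟩
    ∑V (wt i) + (q + q) * pure i + (q + q) * φ f
      ≡⟨ cong (_+ (q + q) * φ f) (sym (trans (∑-distrib-+ (λ k → wt i (nth k)) (λ k → (q + q) * χ (Pure? i (nth k))))
           (cong (∑V (wt i) +_) (sym (sum-*ˡ (q + q) (λ k → χ (Pure? i (nth k)))))))) ⟩
    ∑V (λ v → wt i v + (q + q) * χ (Pure? i v)) + (q + q) * φ f
      ≤⟨ ℕ.+-monoˡ-≤ _ (∑Q-mono d (wt-pure i)) ⟩
    ∑V (λ _ → (q + q) + 2) + (q + q) * φ f
      ≡⟨ cong (_+ (q + q) * φ f) (∑Q-const ((q + q) + 2)) ⟩
    N * ((q + q) + 2) + (q + q) * φ f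
      ≡⟨ collect N q (φ f) ⟩
    (q + q) * N + 2 * (N + q * φ f) ∎))
    where
    open ℕ.≤-Reasoning
    shuffle : ∀ W q m a → W + (q + q) * m + 2 * (q * a) ≡ W + (q + q) * a + (q + q) * m
    shuffle = solve-∀
    collect : ∀ N q m → N * ((q + q) + 2) + (q + q) * m ≡ (q + q) * N + 2 * (N + q * m)
    collect = solve-∀

  cover-inequality : N ≤ sum pure + mixed
  cover-inequality = begin
    N                                                  ≡⟨ trans (∑Q-const 1) (ℕ.*-identityʳ N) ⟨
    ∑V (λ _ → 1)                                       ≤⟨ ∑Q-mono d cover ⟩
    ∑V (λ v → sum (λ i → χ (Pure? i v)) + χ (Mixed? v)) ≡⟨ ∑-distrib-+ (λ k → sum (λ i → χ (Pure? i (nth k)))) (λ k → χ (Mixed? (nth k))) ⟩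
    ∑V (λ v → sum (λ i → χ (Pure? i v))) + mixed        ≡⟨ cong (_+ mixed) (∑-comm (λ i k → χ (Pure? i (nth k)))) ⟨
    sum pure + mixed                                    ∎
    where
    open ℕ.≤-Reasoning
    cover : ∀ v → 1 ≤ sum (λ i → χ (Pure? i v)) + χ (Mixed? v)
    cover v = case Mixed? v of λ
      { (yes m) → ℕ.≤-trans (ℕ.≤-reflexive (sym (χ-yes (Mixed? v) m))) (ℕ.m≤n+m _ _)
      ; (no ¬m) → ℕ.≤-trans (ℕ.≤-reflexive (sym (χ-yes (Pure? (dom v) v) (refl , ¬m))))
                    (ℕ.≤-trans (≤-sum (λ i → χ (Pure? i v)) (dom v)) (ℕ.m≤m+n _ _)) }

  boundary-inequality : ∀ s .{{_ : NonZero d}} → d ≤ s * s → ∀ i c → pure i + c ≡ N → pure i * c ≤ 8 * s * N * mixed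
  boundary-inequality s d≤s² i c eq = ℕ.+-cancelˡ-≤ (8 * s * N * pure i) _ _ (begin
    8 * s * N * pure i + pure i * c
      ≤⟨ isoperimetry d s d≤s² (Pure? i) (λ v → Pure? i v ⊎-dec Mixed? v) (λ v → inj₁) (Pure-closed i) c eq ⟩
    8 * s * N * size d (λ v → Pure? i v ⊎-dec Mixed? v)
      ≤⟨ ℕ.*-monoʳ-≤ (8 * s * N) union ⟩
    8 * s * N * (pure i + mixed)
      ≡⟨ ℕ.*-distribˡ-+ (8 * s * N) (pure i) mixed ⟩
    8 * s * N * pure i + 8 * s * N * mixed ∎)
    where
    open ℕ.≤-Reasoning
    χ-⊎ : ∀ v → χ (Pure? i v ⊎-dec Mixed? v) ≤ χ (Pure? i v) + χ (Mixed? v)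
    χ-⊎ v = case Pure? i v ⊎-dec Mixed? v of λ
      { (no ¬p) → ℕ.≤-trans (ℕ.≤-reflexive (χ-no (Pure? i v ⊎-dec Mixed? v) ¬p)) z≤n
      ; (yes (inj₁ p)) → ℕ.≤-trans (χ≤1 (Pure? i v ⊎-dec Mixed? v))
          (ℕ.≤-trans (ℕ.≤-reflexive (sym (χ-yes (Pure? i v) p))) (ℕ.m≤m+n _ _))
      ; (yes (inj₂ m)) → ℕ.≤-trans (χ≤1 (Pure? i v ⊎-dec Mixed? v))
          (ℕ.≤-trans (ℕ.≤-reflexive (sym (χ-yes (Mixed? v) m))) (ℕ.m≤n+m _ _)) }
    union : size d (λ v → Pure? i v ⊎-dec Mixed? v) ≤ pure i + mixed
    union = ℕ.≤-trans (∑Q-mono d χ-⊎) (ℕ.≤-reflexive (∑-distrib-+ (λ k → χ (Pure? i (nth k))) (λ k → χ (Mixed? (nth k)))))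

-- Arithmetic of the lower bound

module _ (r s q N S m : ℕ) (a : Fin r → ℕ) .{{_ : NonZero N}} (2≤r : 2 ≤ r) (1≤s : 1 ≤ s) (q-large : 132 * s * r ≤ q)
         (mixed-ineq : q * S + (q + q) * N ≤ N * 2 + (q + q) * (r * m))
         (pure-ineq : ∀ i → q * a i ≤ N + q * m)
         (cover-ineq : N ≤ sum a + S)
         (boundary-ineq : ∀ i c → a i + c ≡ N → a i * c ≤ 8 * s * N * S) where
  private
    1≤r : 1 ≤ r
    1≤r = ℕ.≤-trans (s≤s z≤n) 2≤r

    1≤sr : 1 ≤ s * r
    1≤sr = ℕ.*-mono-≤ 1≤s 1≤r

    instance
      q-nonZero : NonZero q
      q-nonZero = >-nonZero (ℕ.≤-trans (ℕ.*-mono-≤ (ℕ.*-mono-≤ {1} {132} (s≤s z≤n) 1≤s) 1≤r) q-large)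

    -- Both cases of `excess` bound four times r m - N from below: by `N` if one pure set is large,
    -- by `S` otherwise.
    conclude : ∀ X → 4 * N + X ≤ 4 * (r * m) → N ≤ 33 * (s * r) * X → ∃[ h ] r * m ≡ N + h × N ≤ 132 * (s * r) * h
    conclude X le N≤ = r * m ∸ N , sym eq , (begin
      N                                        ≤⟨ N≤ ⟩
      33 * (s * r) * X                         ≤⟨ ℕ.*-monoʳ-≤ (33 * (s * r)) X≤4h ⟩
      33 * (s * r) * (4 * (r * m ∸ N))         ≡⟨ collect (s * r) (r * m ∸ N) ⟩
      132 * (s * r) * (r * m ∸ N)              ∎)
      where
      open ℕ.≤-Reasoning
      eq : N + (r * m ∸ N) ≡ r * m
      eq = ℕ.m+[n∸m]≡n {N} {r * m} (ℕ.*-cancelˡ-≤ 4 (ℕ.≤-trans (ℕ.m≤m+n (4 * N) X) le))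
      X≤4h : X ≤ 4 * (r * m ∸ N)
      X≤4h = ℕ.+-cancelˡ-≤ (4 * N) _ _ (subst (4 * N + X ≤_)
        (trans (cong (4 *_) (sym eq)) (ℕ.*-distribˡ-+ 4 N _)) le)
      collect : ∀ x h → 33 * x * (4 * h) ≡ 132 * x * h
      collect = solve-∀

    -- Since r ≥ 2, r m ≥ 3N/2 - rN/q, and 4r ≤ q leaves 5N/4. With other constants, any proportion
    -- strictly between 1/2 and 1 could replace 3/4: above 1/2 for this case, below 1 for
    -- `all-small`.
    one-large : ∀ i → 3 * N < 4 * a i → 4 * N + N ≤ 4 * (r * m)
    one-large i large = ℕ.*-cancelˡ-≤ q (ℕ.+-cancelˡ-≤ (q * N) _ _ (begin
      q * N + q * (4 * N + N)                  ≡⟨ lhs q N ⟩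
      2 * (3 * (q * N))                        ≤⟨ ℕ.*-monoˡ-≤ (3 * (q * N)) 2≤r ⟩
      r * (3 * (q * N))                        ≡⟨ cong (r *_) (swap q N) ⟩
      r * (q * (3 * N))                        ≤⟨ ℕ.*-monoʳ-≤ r (ℕ.*-monoʳ-≤ q (ℕ.<⇒≤ large)) ⟩
      r * (q * (4 * a i))                      ≡⟨ pull r q (a i) ⟩
      4 * r * (q * a i)                        ≤⟨ ℕ.*-monoʳ-≤ (4 * r) (pure-ineq i) ⟩
      4 * r * (N + q * m)                      ≡⟨ spread r N q m ⟩
      4 * r * N + q * (4 * (r * m))            ≤⟨ ℕ.+-monoˡ-≤ _ (ℕ.*-monoˡ-≤ N 4r≤q) ⟩
      q * N + q * (4 * (r * m))                ∎))
      where
      open ℕ.≤-Reasoning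
      lhs : ∀ q N → q * N + q * (4 * N + N) ≡ 2 * (3 * (q * N))
      lhs = solve-∀
      swap : ∀ q N → 3 * (q * N) ≡ q * (3 * N)
      swap = solve-∀
      pull : ∀ r q a → r * (q * (4 * a)) ≡ 4 * r * (q * a)
      pull = solve-∀
      spread : ∀ r N q m → 4 * r * (N + q * m) ≡ 4 * r * N + q * (4 * (r * m))
      spread = solve-∀
      4r≤q : 4 * r ≤ q
      4r≤q = ℕ.≤-trans (ℕ.*-monoˡ-≤ r (ℕ.*-mono-≤ {4} {132} {1} {s} (ℕ.m≤m+n 4 128) 1≤s)) q-large

    -- Each complement has at least N/4 elements, so the boundary inequality gives a i ≤ 4 · 8 s S.
    -- The `r` pure sets contribute 32 s r S, and `S` itself at most one more s r S.
    all-small : (∀ i → 4 * a i ≤ 3 * N) → N ≤ 33 * (s * r) * S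
    all-small small = begin
      N                                 ≤⟨ cover-ineq ⟩
      sum a + S                         ≤⟨ ℕ.+-monoˡ-≤ S (sum-mono bound) ⟩
      sum {r} (λ _ → 32 * s * S) + S    ≡⟨ cong (_+ S) (sum-const r (32 * s * S)) ⟩
      r * (32 * s * S) + S              ≤⟨ ℕ.+-monoʳ-≤ _ (ℕ.≤-trans (ℕ.≤-reflexive (sym (ℕ.*-identityˡ S))) (ℕ.*-monoˡ-≤ S 1≤sr)) ⟩
      r * (32 * s * S) + s * r * S      ≡⟨ collect r s S ⟩
      33 * (s * r) * S                  ∎
      where
      open ℕ.≤-Reasoning
      collect : ∀ r s S → r * (32 * s * S) + s * r * S ≡ 33 * (s * r) * S
      collect = solve-∀
      bound : ∀ i → a i ≤ 32 * s * S
      bound i = ℕ.*-cancelʳ-≤ _ _ N (begin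
        a i * N                 ≤⟨ ℕ.*-monoʳ-≤ (a i) N≤4c ⟩
        a i * (4 * c)           ≡⟨ swap (a i) c ⟩
        4 * (a i * c)           ≤⟨ ℕ.*-monoʳ-≤ 4 (boundary-ineq i c eq) ⟩
        4 * (8 * s * N * S)     ≡⟨ rearrange s N S ⟩
        32 * s * S * N          ∎)
        where
        c = N ∸ a i
        eq : a i + c ≡ N
        eq = ℕ.m+[n∸m]≡n {a i} {N} (ℕ.*-cancelˡ-≤ 4 (ℕ.≤-trans (small i) (ℕ.*-monoˡ-≤ N {3} {4} (ℕ.n≤1+n 3))))
        swap : ∀ a c → a * (4 * c) ≡ 4 * (a * c)
        swap = solve-∀
        rearrange : ∀ s N S → 4 * (8 * s * N * S) ≡ 32 * s * S * N
        rearrange = solve-∀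
        N≤4c : N ≤ 4 * c
        N≤4c = ℕ.+-cancelˡ-≤ (3 * N) _ _ (begin
          3 * N + N             ≡⟨ ℕ.+-comm (3 * N) N ⟩
          4 * N                 ≡⟨ cong (4 *_) eq ⟨
          4 * (a i + c)         ≡⟨ ℕ.*-distribˡ-+ 4 (a i) c ⟩
          4 * a i + 4 * c       ≤⟨ ℕ.+-monoˡ-≤ (4 * c) (small i) ⟩
          3 * N + 4 * c         ∎)

    -- The inequality for `S` gives r m ≥ N + S/2 - N/q. The constant 132 = 4 · 33 makes N/q at most
    -- S/4, so half of the gain remains.
    boundary-large : N ≤ 33 * (s * r) * S → 4 * N + S ≤ 4 * (r * m)
    boundary-large N≤ = ℕ.*-cancelˡ-≤ q (ℕ.+-cancelˡ-≤ (4 * N) _ _ (begin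
      4 * N + q * (4 * N + S)                       ≤⟨ ℕ.+-monoˡ-≤ _ 4N≤qS ⟩
      q * S + q * (4 * N + S)                       ≡⟨ double q S N ⟩
      2 * (q * S + (q + q) * N)                     ≤⟨ ℕ.*-monoʳ-≤ 2 mixed-ineq ⟩
      2 * (N * 2 + (q + q) * (r * m))               ≡⟨ spread N q (r * m) ⟩
      4 * N + q * (4 * (r * m))                     ∎))
      where
      open ℕ.≤-Reasoning
      double : ∀ q S N → q * S + q * (4 * N + S) ≡ 2 * (q * S + (q + q) * N)
      double = solve-∀
      spread : ∀ N q x → 2 * (N * 2 + (q + q) * x) ≡ 4 * N + q * (4 * x)
      spread = solve-∀
      quadruple : ∀ s r S → 4 * (33 * (s * r) * S) ≡ 132 * s * r * S
      quadruple = solve-∀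
      4N≤qS : 4 * N ≤ q * S
      4N≤qS = begin
        4 * N                       ≤⟨ ℕ.*-monoʳ-≤ 4 N≤ ⟩
        4 * (33 * (s * r) * S)      ≡⟨ quadruple s r S ⟩
        132 * s * r * S             ≤⟨ ℕ.*-monoˡ-≤ S q-large ⟩
        q * S                       ∎

  excess : ∃[ h ] r * m ≡ N + h × N ≤ 132 * (s * r) * h
  excess with Fin.any? (λ i → 3 * N <? 4 * a i)
  ... | yes (i , large) = conclude N (one-large i large)
    (ℕ.≤-trans (ℕ.≤-reflexive (sym (ℕ.*-identityˡ N))) (ℕ.*-monoˡ-≤ N (ℕ.*-mono-≤ {1} {33} (s≤s z≤n) 1≤sr)))
  ... | no none = conclude S (boundary-large N≤) N≤
    where
    N≤ : N ≤ 33 * (s * r) * S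
    N≤ = all-small λ i → ℕ.≮⇒≥ λ large → none (i , large)


-- Choice of parameters and the final bounds

square-root : ∀ d → ∃[ t ] t * t ≤ d × d < suc t * suc t
square-root zero = 0 , z≤n , s≤s z≤n
square-root (suc d) with square-root d
... | t , t²≤d , d<[1+t]² with suc d <? suc t * suc t
...   | yes lt = t , ℕ.m≤n⇒m≤1+n t²≤d , lt
...   | no ≮   = suc t , ℕ.≮⇒≥ ≮ , ℕ.≤-<-trans d<[1+t]² (ℕ.*-mono-< (ℕ.n<1+n (suc t)) (ℕ.n<1+n (suc t)))

-- The dimension beyond which ⌊d/r⌋ ≥ 132 r (1 + ⌊√d⌋), so that the terms of order N/d are negligible.
threshold : ℕ → ℕ
threshold r = (2 * (132 * (r * r))) * (2 * (132 * (r * r)))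

large-root : ∀ a d t → a * a ≤ d → d < suc t * suc t → a ≤ t
large-root a d t a²≤d d<[1+t]² = ℕ.≮⇒≥ λ t<a → ℕ.<⇒≱ d<[1+t]² (ℕ.≤-trans (ℕ.*-mono-≤ t<a t<a) a²≤d)

suc≤2* : ∀ t → 1 ≤ t → suc t ≤ 2 * t
suc≤2* t 1≤t = ℕ.≤-trans (ℕ.+-monoˡ-≤ t 1≤t) (ℕ.≤-reflexive (cong (t +_) (sym (ℕ.+-identityʳ t))))

large-quotient : ∀ k r d t .{{_ : NonZero r}} → 1 ≤ t → 2 * (k * (r * r)) ≤ t → t * t ≤ d → k * suc t * r ≤ d / r
large-quotient k r d t 1≤t le t²≤d = subst (_≤ d / r) (m*n/n≡m (k * suc t * r) r) (/-monoˡ-≤ r (begin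
  k * suc t * r * r             ≡⟨ regroup k (suc t) r ⟩
  k * (r * r) * suc t           ≤⟨ ℕ.*-monoʳ-≤ (k * (r * r)) (suc≤2* t 1≤t) ⟩
  k * (r * r) * (2 * t)         ≡⟨ swap (k * (r * r)) t ⟩
  2 * (k * (r * r)) * t         ≤⟨ ℕ.*-monoˡ-≤ t le ⟩
  t * t                         ≤⟨ t²≤d ⟩
  d                             ∎))
  where
  open ℕ.≤-Reasoning
  regroup : ∀ k s r → k * s * r * r ≡ k * (r * r) * s
  regroup = solve-∀
  swap : ∀ P t → P * (2 * t) ≡ 2 * P * t
  swap = solve-∀

lower-squared : ∀ k r t N h d → N ≤ k * (suc t * r) * h → 1 ≤ t → t * t ≤ d →
                N * N ≤ (2 * k * r) * (2 * k * r) * (suc h * suc h * d)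
lower-squared k r t N h d N≤ 1≤t t²≤d = begin
  N * N                                             ≤⟨ ℕ.*-mono-≤ N≤′ N≤′ ⟩
  (k * (2 * t * r) * H) * (k * (2 * t * r) * H)     ≡⟨ regroup k t r H ⟩
  (2 * k * r) * (2 * k * r) * (H * H * (t * t))     ≤⟨ ℕ.*-monoʳ-≤ ((2 * k * r) * (2 * k * r)) (ℕ.*-monoʳ-≤ (H * H) t²≤d) ⟩
  (2 * k * r) * (2 * k * r) * (H * H * d)           ∎
  where
  open ℕ.≤-Reasoning
  H = suc h
  N≤′ : N ≤ k * (2 * t * r) * H
  N≤′ = ℕ.≤-trans N≤ (ℕ.*-mono-≤ (ℕ.*-monoʳ-≤ k (ℕ.*-monoˡ-≤ r (suc≤2* t 1≤t))) (ℕ.n≤1+n h))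
  regroup : ∀ k t r H → (k * (2 * t * r) * H) * (k * (2 * t * r) * H) ≡ (2 * k * r) * (2 * k * r) * (H * H * (t * t))
  regroup = solve-∀

-- Because 1 ≤ L, the extra 1 in `suc h` costs only one more `L`; hence the constant 2r + 1.
upper-squared : ∀ r L N h d → 1 ≤ L → h ≤ r * (L + L) → L * L * d ≤ N * N →
                suc h * suc h * d ≤ (suc (2 * r) * N) * (suc (2 * r) * N)
upper-squared r L N h d 1≤L h≤ L²d≤ = begin
  suc h * suc h * d                     ≤⟨ ℕ.*-monoˡ-≤ d (ℕ.*-mono-≤ H≤ H≤) ⟩
  (k * L) * (k * L) * d                 ≡⟨ regroup k L d ⟩
  k * k * (L * L * d)                   ≤⟨ ℕ.*-monoʳ-≤ (k * k) L²d≤ ⟩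
  k * k * (N * N)                       ≡⟨ square-* k N ⟩
  (k * N) * (k * N)                     ∎
  where
  open ℕ.≤-Reasoning
  k = suc (2 * r)
  regroup : ∀ k L d → (k * L) * (k * L) * d ≡ k * k * (L * L * d)
  regroup = solve-∀
  square-* : ∀ k N → k * k * (N * N) ≡ (k * N) * (k * N)
  square-* = solve-∀
  scale : ∀ r L → r * (L + L) ≡ 2 * r * L
  scale = solve-∀
  H≤ : suc h ≤ suc (2 * r) * L
  H≤ = ℕ.+-mono-≤ 1≤L (ℕ.≤-trans h≤ (ℕ.≤-reflexive (scale r L)))

-- The constant 132 of excess, doubled because 1 + ⌊√d⌋ ≤ 2 ⌊√d⌋.
constant : ℕ → ℕ
constant r = 2 * 132 * r

module _ (r : ℕ) .{{_ : NonZero r}} (2≤r : 2 ≤ r) (d : ℕ) (d≥ : threshold r ≤ d) where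
  open Cube d r using (N; φ; optimal)

  private
    1≤r : 1 ≤ r
    1≤r = ℕ.≤-trans (s≤s z≤n) 2≤r

  excess-Q : ∃[ h ] r * φ optimal ≡ N + h × N * N ≤ constant r * constant r * (suc h * suc h * d)
  excess-Q with square-root d
  ... | t , t²≤d , d<[1+t]² =
    let 2P≤t = large-root (2 * (132 * (r * r))) d t d≥ d<[1+t]²
        1≤t = ℕ.≤-trans (ℕ.*-mono-≤ {1} {2} (s≤s z≤n) (ℕ.*-mono-≤ {1} {132} (s≤s z≤n) (ℕ.*-mono-≤ 1≤r 1≤r))) 2P≤t
        instance
          d-nonZero : NonZero d
          d-nonZero = >-nonZero (ℕ.≤-trans (ℕ.*-mono-≤ 1≤t 1≤t) t²≤d)
        module C = Counting d r (d / r) (subst (_≤ d) (ℕ.*-comm (d / r) r) (m/n*n≤m d r)) optimal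
        -- The root of `d` is rounded up to `suc t` where isoperimetry needs d ≤ s², and down to `t`
        -- where the final estimate needs t² ≤ d.
        (h , eq , N≤) = excess r (suc t) (d / r) N C.mixed (φ optimal) C.pure {{ℕ.m^n≢0 2 d}} 2≤r (s≤s z≤n)
          (large-quotient 132 r d t 1≤t 2P≤t t²≤d)
          C.mixed-inequality C.pure-inequality C.cover-inequality (C.boundary-inequality (suc t) (ℕ.<⇒≤ d<[1+t]²))
    in h , eq , lower-squared 132 r t N h d N≤ 1≤t t²≤d

  optimal-upper : ∀ h → r * φ optimal ≡ N + h → suc h * suc h * d ≤ (suc (2 * r) * N) * (suc (2 * r) * N)
  optimal-upper h eq =
    let (L , 1≤L , layer≤L , L²d≤) = layer-bound d
    in upper-squared r L N h d 1≤L
         (ℕ.+-cancelˡ-≤ N _ _ (subst (_≤ N + r * (L + L)) eq (LayeredColouring.optimal-bound d r L layer≤L))) L²d≤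

-- The three conditions of the Θ-statement for a single dimension, with the quantity under the root
-- left free so that `subst` can exchange the logarithm for `d`.
ScaledBounds : (r N m d k K : ℕ) .{{_ : NonZero r}} .{{_ : NonZero K}} → Set
ScaledBounds r N m d k K = let D = discrepancy r N m ; c = pos 1 ℚ./ K in
    ℚ.0ℚ ℚ.≤ D
  × (c ℚ.* fromℕ N) ℚ.* (c ℚ.* fromℕ N) ℚ.≤ D ℚ.* D ℚ.* fromℕ d
  × D ℚ.* D ℚ.* fromℕ d ℚ.≤ (fromℕ k ℚ.* fromℕ N) ℚ.* (fromℕ k ℚ.* fromℕ N)

-- When r m = N + h the discrepancy r m - (N - 1) is `suc h`, a natural number, which also gives its
-- nonnegativity.
scaled-bounds : ∀ r N m h d k K .{{_ : NonZero r}} .{{_ : NonZero K}} → r * m ≡ N + h →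
  N * N ≤ K * K * (suc h * suc h * d) → suc h * suc h * d ≤ (k * N) * (k * N) → ScaledBounds r N m d k K
scaled-bounds r N m h d k K eq lower upper
  rewrite discrepancy-fromℕ r N m (suc h) (trans (cong (_+ 1) eq) (trans (ℕ.+-comm (N + h) 1) (sym (ℕ.+-suc N h)))) =
  0≤fromℕ (suc h) , lower-ℚ K N (suc h) d lower , upper-ℚ k N (suc h) d upper

corollary1p8 : (r : ℕ) .{{_ : NonZero r}} → 2 ≤ r →
    ∃[ D ] (∀ d → IsSpanningTreeDiscrepancy r (Q d) (D d))
    × D =Θ[ (λ d → 2 ^ d) /√ (λ d → ⌊log₂ (2 ^ d) ⌋) ]
corollary1p8 r 2≤r =
    (λ d → discrepancy r (2 ^ d) (Cube.φ d r (Cube.optimal d r)))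
  , (λ d → Cube.isSpanningTreeDiscrepancy d r)
  , pos 1 ℚ./ constant r , fromℕ (suc (2 * r))
  , ℚ.positive⁻¹ _ {{ℚ.normalize-pos 1 (constant r)}}
  , ℚ.positive⁻¹ _ {{ℚ.normalize-pos (suc (2 * r)) 1}}
  , threshold r
  , bounds
  where
  instance
    constant-nonZero : NonZero (constant r)
    constant-nonZero = ℕ.m*n≢0 (2 * 132) r
  bounds : ∀ d → threshold r ≤ d →
    ScaledBounds r (2 ^ d) (Cube.φ d r (Cube.optimal d r)) ⌊log₂ (2 ^ d) ⌋ (suc (2 * r)) (constant r)
  bounds d d≥ =
    let (h , eq , lower) = excess-Q r 2≤r d d≥
    in subst (λ k → ScaledBounds r (2 ^ d) (Cube.φ d r (Cube.optimal d r)) k (suc (2 * r)) (constant r))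
         (sym (⌊log₂[2^n]⌋≡n d))
         (scaled-bounds r (2 ^ d) (Cube.φ d r (Cube.optimal d r)) h d (suc (2 * r)) (constant r) eq lower
           (optimal-upper r 2≤r d d≥ h eq))
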